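{- Let $F:\{0,1\}^3\to\mathbb{Q}_{\ge0}$. The following are equivalent: (1) $F$ is windable; (2) for all $x_1,x_2,x_3\in\{0,1\}$, $F(x_1,x_2,x_3)F(1-x_1,1-x_2,1-x_3)\le F(x_1,x_2,1-x_3)F(1-x_1,1-x_2,x_3)+F(x_1,1-x_2,x_3)F(1-x_1,x_2,1-x_3)+F(x_1,1-x_2,1-x_3)F(1-x_1,x_2,x_3)$; (3) $F$ has a matchings circuit.
   Context: For $x,y\in\{0,1\}^J$, $x\oplus y$ is coordinatewise addition mod 2, and $\mathbf S$ is the characteristic vector of $S\subseteq J$. For $z\in\{0,1\}^J$, $\mathrm{Match}'(z)$ is the set of partitions of $\{i:z_i=1\}$ into blocks of size 1 or 2. $F:\{0,1\}^J\to\mathbb{Q}_{\ge0}$ is windable if there exist $B(x,y,M)\ge0$ for all $x,y\in\{0,1\}^J$ and $M\in\mathrm{Match}'(x\oplus y)$ with (1) $F(x)F(y)=\sum_{M\in\mathrm{Match}'(x\oplus y)}B(x,y,M)$ for all $x,y$, and (2) $B(x,y,M)=B(x\oplus\mathbf S,y\oplus\mathbf S,M)$ for all $x,y$ and all $S\in M\in\mathrm{Match}'(x\oplus y)$. A matchings circuit $G$ consists of: a finite set $J$ of incidences; a finite vertex set $V$ with sets $J_v$ partitioning $J$; a set $A\subseteq J$ of external edges; a partition $E$ of $J\setminus A$ into pairs (internal edges); a rational edge-weight $w(e)\ge0$ for each $e\in E$; and a rational fugacity $\lambda(v)\ge0$ for each $v$. For $F\subseteq A\cup E$, $\deg_F(v)$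 is the number of incidences in $J_v$ belonging to edges of $F$; $\mathrm{wt}_G(F)=0$ if some $\deg_F(v)\ge2$, else $\prod_{v:\deg_F(v)=0}\lambda(v)\prod_{e\in F\cap E}w(e)$. The signature $[\![G]\!]:\{0,1\}^A\to\mathbb{Q}_{\ge0}$ is $[\![G]\!](x)=\sum\mathrm{wt}_G(F)$ over $F\subseteq A\cup E$ with $F\cap A=\{a:x_a=1\}$. $F$ has a matchings circuit if $F=[\![G]\!]$ for some $G$ (with $A$ identified with $\{1,2,3\}$ via a bijection). -}

module Defs where

open import Data.Bool using (Bool; true; false; not; _xor_; if_then_else_)
import Data.Bool.Properties as Bool
open import Data.Fin using (Fin)
open import Data.Fin.Properties using (any?)
open import Data.Fin.Subset using (Subset; inside; outside; _∈_; _∩_; _∪_; ∁; ⋃; ∣_∣; Empty)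
open import Data.Fin.Subset.Properties using (_∈?_; nonempty?)
open import Data.List using (List; []; _∷_; _++_; map; filter; foldr; allFin)
open import Data.List.Membership.Propositional using () renaming (_∈_ to _∈ˡ_)
open import Data.List.Relation.Unary.All using (All; all?)
open import Data.List.Relation.Unary.AllPairs using (AllPairs; allPairs?)
open import Data.Nat using (ℕ; zero; suc; _≟_; _≤?_)
open import Data.Product using (Σ-syntax; ∃!; _×_; _,_)
open import Data.Rational using (ℚ; 0ℚ; 1ℚ; _+_; _*_; _≤_)
open import Data.Sum using (_⊎_)
open import Data.Vec using (Vec; []; _∷_; zipWith; lookup; tabulate)
open import Data.Vec.Properties using (≡-dec)
open import Function.Bundles using (_⤖_; module Bijection)
open import Relation.Binary.PropositionalEquality using (_≡_)
open import Relation.Nullary using (Dec; yes; no; does; ¬?)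
open import Relation.Nullary.Decidable using (_×-dec_; _⊎-dec_)

Σℚ : {A : Set} → List A → (A → ℚ) → ℚ
Σℚ xs f = foldr (λ x s → f x + s) 0ℚ xs

Πℚ : {A : Set} → List A → (A → ℚ) → ℚ
Πℚ xs f = foldr (λ x p → f x * p) 1ℚ xs

-- Each subset of a duplicate-free list is listed exactly once, as a sublist.
sublists : {A : Set} → List A → List (List A)
sublists []       = [] ∷ []
sublists (x ∷ xs) = map (x ∷_) (sublists xs) ++ sublists xs

subsets : (n : ℕ) → List (Subset n)
subsets zero    = [] ∷ []
subsets (suc n) = map (inside ∷_) (subsets n) ++ map (outside ∷_) (subsets n)

-- A finite index set J is Fin n, and {0,1}ᴶ is Vec Bool n with true for 1.
-- Since Subset n is Vec Bool n, with inside = true, a subset is its own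
-- characteristic vector.

infixl 6 _⊕_

_⊕_ : ∀ {n} → Vec Bool n → Vec Bool n → Vec Bool n
_⊕_ = zipWith _xor_

-- M lists the blocks of a partition of z, with all block sizes satisfying P.
-- When P excludes 0, disjointness makes M duplicate-free.
IsPartition : ∀ {n} → (ℕ → Set) → Subset n → List (Subset n) → Set
IsPartition P z M =
  All (λ S → P ∣ S ∣) M × AllPairs (λ S T → Empty (S ∩ T)) M × ⋃ M ≡ z

isPartition? : ∀ {n} {P : ℕ → Set} → (∀ k → Dec (P k)) →
               (z : Subset n) (M : List (Subset n)) → Dec (IsPartition P z M)
isPartition? P? z M =
  all? (λ S → P? ∣ S ∣) M
    ×-dec allPairs? (λ S T → ¬? (nonempty? (S ∩ T))) M
    ×-dec ≡-dec Bool._≟_ (⋃ M) z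

OneOrTwo : ℕ → Set
OneOrTwo k = k ≡ 1 ⊎ k ≡ 2

oneOrTwo? : ∀ k → Dec (OneOrTwo k)
oneOrTwo? k = (k ≟ 1) ⊎-dec (k ≟ 2)

-- Blocks appear in the order of `subsets n`, so every partition occurs once.
Match′ : ∀ {n} → Vec Bool n → List (List (Subset n))
Match′ {n} z = filter (isPartition? oneOrTwo? z) (sublists (subsets n))

-- The values B x y M with M not in Match′ (x ⊕ y) are unconstrained.
record Windable {n : ℕ} (F : Vec Bool n → ℚ) : Set where
  field
    B           : Vec Bool n → Vec Bool n → List (Subset n) → ℚ
    nonNegative : ∀ x y M → M ∈ˡ Match′ (x ⊕ y) → 0ℚ ≤ B x y M
    sums        : ∀ x y → F x * F y ≡ Σℚ (Match′ (x ⊕ y)) (B x y)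
    invariant   : ∀ x y M S → M ∈ˡ Match′ (x ⊕ y) → S ∈ˡ M →
                  B x y M ≡ B (x ⊕ S) (y ⊕ S) M

-- Incidences are Fin #J and vertices are Fin #V.  Values of w outside E are
-- irrelevant.
record MatchingsCircuit : Set where
  field
    #J          : ℕ
    #V          : ℕ
    J           : Fin #V → Subset #J
    J-partition : ∀ j → ∃! _≡_ (λ v → j ∈ J v)
    A           : Subset #J
    E           : List (Subset #J)
    E-partition : IsPartition (_≡ 2) (∁ A) E
    w           : Subset #J → ℚ
    w-nonNeg    : ∀ e → e ∈ˡ E → 0ℚ ≤ w e
    fugacity    : Fin #V → ℚ
    fugacity-nonNeg : ∀ v → 0ℚ ≤ fugacity v

  External : Set
  External = Σ[ a ∈ Fin #J ] a ∈ A

  -- An edge set F ⊆ A ∪ E is given by X = F ∩ A and D = F ∩ E.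

  deg : Subset #J → List (Subset #J) → Fin #V → ℕ
  deg X D v = ∣ J v ∩ (X ∪ ⋃ D) ∣

  wt : Subset #J → List (Subset #J) → ℚ
  wt X D =
    if does (any? (λ v → 2 ≤? deg X D v))
    then 0ℚ
    else Πℚ (filter (λ v → deg X D v ≟ 0) (allFin #V)) fugacity * Πℚ D w

  -- {a ∈ A : x a = 1} as a set of incidences
  support : (External → Bool) → Subset #J
  support x = tabulate λ j → value j (j ∈? A)
    where
    value : ∀ j → Dec (j ∈ A) → Bool
    value j (yes j∈A) = x (j , j∈A)
    value j (no  _)   = false

  signature : (External → Bool) → ℚ
  signature x = Σℚ (sublists E) (wt (support x))

HasMatchingsCircuit : ∀ {n} → (Vec Bool n → ℚ) → Set
HasMatchingsCircuit {n} F =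
  Σ[ G ∈ MatchingsCircuit ]
  Σ[ φ ∈ MatchingsCircuit.External G ⤖ Fin n ]
    (∀ x → F x ≡ MatchingsCircuit.signature G (λ a → lookup x (Bijection.to φ a)))

ComplementInequality : (Vec Bool 3 → ℚ) → Set
ComplementInequality F = ∀ x₁ x₂ x₃ →
  f x₁ x₂ x₃ * f (not x₁) (not x₂) (not x₃)
    ≤ f x₁ x₂ (not x₃) * f (not x₁) (not x₂) x₃
    + f x₁ (not x₂) x₃ * f (not x₁) x₂ (not x₃)
    + f x₁ (not x₂) (not x₃) * f (not x₁) x₂ x₃
  where
  f : Bool → Bool → Bool → ℚ
  f a b c = F (a ∷ b ∷ c ∷ [])

{-# OPTIONS --safe #-}
-- Write p₀, p₁, p₂, p₃ for the four products F(x) F(x̄).  The inequalities say that no pᵢ exceeds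
-- the sum of the other three, which is exactly when they are the vertex sums of nonnegative edge
-- weights u on K₄.
--
-- Windability is such a choice of u: flipping a block of a two-block partition of {1,2,3}
-- exchanges the classes pᵢ in two pairs, so these partitions are the perfect matchings of K₄.
--
-- From u a circuit is read off: by flipping external edges we may assume κ = F(111) ≠ 0, and
-- then a graph on five vertices works, with an edge weight aᵢ solving aᵢ mⱼ mₖ = uⱼₖ, where
-- mᵢ is the value of F at 111 with the i-th coordinate flipped.
--
-- Conversely, fix the symmetric difference of two edge sets with complementary external parts.
-- Exchanging the two along its connected component through the third external edge preserves
-- weights, and degrees at most two mean that the component, a path, contains at most one other
-- external edge.  Summing over all symmetric differences gives the inequality.
module Submission where

open import Defs
open import Data.Bool using (Bool; true; false; not; _∨_; _xor_; if_then_else_)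
open import Data.Bool.Properties using (not-involutive; xor-comm)
open import Data.Empty using (⊥-elim)
open import Data.Fin using (Fin; zero; suc)
open import Data.Fin.Patterns using (0F; 1F; 2F; 3F; 4F)
import Data.Fin.Properties as Fin
open import Data.Fin.Subset using (Subset; inside; outside; _∈_; _⊆_; _∩_; _∪_; ⊤; ⊥; ∁; ⁅_⁆; ⋃; ∣_∣; Empty)
open import Data.Fin.Subset.Properties using (drop-∷-Empty; ∣⊥∣≡0; ∉⊥; ∈⊤; x∈⁅x⁆; x∈⁅y⁆⇒x≡y; x∈∁p⇒x∉p; _∈?_; ⊆-antisym; ∩-comm; ∩-zeroʳ; x∈p∩q⁺; x∈p∩q⁻; ∪-assoc; ∪-identityˡ; ∪-identityʳ; p⊆p∪q; q⊆p∪q; x∈p∪q⁻)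
open import Data.List using (List; []; _∷_; _++_; map; length; filter; tabulate)
open import Data.List.Membership.Propositional using () renaming (_∈_ to _∈ˡ_)
open import Data.List.Membership.Propositional.Properties using (∈-filter⁻)
open import Data.List.Relation.Binary.Pointwise using (Pointwise; []; _∷_)
open import Data.List.Relation.Unary.All as All using (All; []; _∷_)
import Data.List.Relation.Unary.All.Properties as All
open import Data.List.Relation.Unary.AllPairs as AllPairs using (AllPairs; []; _∷_)
import Data.List.Relation.Unary.AllPairs.Properties as AllPairs
open import Data.List.Relation.Unary.Any using (here; there)
open import Data.Nat as ℕ using (ℕ; zero; suc; s≤s; z≤n)
import Data.Nat.Properties as ℕ
import Data.Nat.Solver as ℕ
open import Data.Product using (Σ-syntax; ∃-syntax; _×_; _,_; proj₁; proj₂)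
open import Data.Rational using (ℚ; 0ℚ; 1ℚ; ½; _+_; _*_; _-_; -_; _≤_; 1/_; NonZero; Positive; nonNegative; ≢-nonZero)
open import Data.Rational.Properties using (_≟_; ≤-refl; ≤-reflexive; ≤-trans; ≤-antisym; ≤-total; +-mono-≤; +-monoˡ-≤; +-monoʳ-≤; +-comm; +-assoc; +-identityˡ; +-identityʳ; +-inverseʳ; *-comm; *-assoc; *-identityˡ; *-identityʳ; *-zeroˡ; *-zeroʳ; *-inverseˡ; *-inverseʳ; *-distribˡ-+; *-cancelʳ-≤-pos; nonNegative⁻¹; nonNeg*nonNeg⇒nonNeg; nonNeg∧nonZero⇒pos)
open import Data.Rational.Solver using (module +-*-Solver)
open import Data.Sum using (_⊎_; inj₁; inj₂; [_,_]′; swap)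
open import Data.Unit using (tt) renaming (⊤ to Unit)
open import Data.Vec as Vec using (Vec; []; _∷_; lookup; here; there)
open import Data.Vec.Properties using ([]=⇒lookup; lookup⇒[]=; lookup∘tabulate; lookup-map; zipWith-comm)
open import Data.Vec.Properties.WithK using ([]=-irrelevant)
open import Function using (_∘_; id; case_of_)
open import Function.Bundles using (_⇔_; mk⇔; _⤖_; _↔_; mk↔ₛ′; module Bijection; module Inverse)
open import Function.Properties.Bijection using (⤖⇒↔)
open import Function.Properties.Inverse using (↔⇒⤖)
open import Relation.Binary.PropositionalEquality using (_≡_; _≢_; _≗_; refl; sym; trans; cong; cong₂; subst; subst₂; module ≡-Reasoning)
open import Relation.Nullary using (Dec; yes; no; ¬_; does; contradiction)
open import Relation.Nullary.Decidable using (dec-true; toSum)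
open +-*-Solver

-- Circuits are first reduced to multigraphs with three marked vertices, where the sum over edge
-- sets becomes a recursion over a list of edges that carries only vertex degrees. No paths are ever
-- formed. Components are labels on vertices, obtained by contracting edges, and what is bounded is
-- the number of edge ends and terminals with a given label. Each contraction consumes two ends, so
-- the bound 2 survives until only terminals are left to count. The five-vertex graph is shaped by
-- parity: a single vertex may stay uncovered, and the number of ones in the input decides whether
-- it does. Multiplying values of its signature at complementary points gives u₀ᵢ = wⱼₖ κ mᵢ and uⱼₖ
-- = aᵢ mⱼ mₖ, which can be solved for w and a. The obstacle is a vanishing mᵢ: then pᵢ = 0, all u
-- at vertex i vanish, and aⱼ, aₖ are set to 0 so that the remaining weights stay nonnegative.

private
  variable
    X Y : Set
    k n : ℕ
    f : Bool → Bool → Bool → ℚ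

-- Rational arithmetic

0≤+ : ∀ {p q} → 0ℚ ≤ p → 0ℚ ≤ q → 0ℚ ≤ p + q
0≤+ 0≤p 0≤q = +-mono-≤ 0≤p 0≤q

0≤* : ∀ {p q} → 0ℚ ≤ p → 0ℚ ≤ q → 0ℚ ≤ p * q
0≤* {p} {q} 0≤p 0≤q =
  nonNegative⁻¹ (p * q) {{nonNeg*nonNeg⇒nonNeg p {{nonNegative 0≤p}} q {{nonNegative 0≤q}}}}

≤⇒0≤- : ∀ {p q} → p ≤ q → 0ℚ ≤ q - p
≤⇒0≤- {p} {q} p≤q = subst (_≤ q - p) (+-inverseʳ p) (+-monoˡ-≤ (- p) p≤q)

0≤-⇒≤ : ∀ {p q} → 0ℚ ≤ q - p → p ≤ q
0≤-⇒≤ {p} {q} 0≤q-p =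
  subst (p ≤_) (solve 2 (λ p q → p :+ (q :- p) := q) refl p q)
    (subst (_≤ p + (q - p)) (+-identityʳ p) (+-monoʳ-≤ p 0≤q-p))

0≤½* : ∀ {p} → 0ℚ ≤ p → 0ℚ ≤ ½ * p
0≤½* = 0≤* (nonNegative⁻¹ ½)

≤-zero : ∀ {p} → 0ℚ ≤ p → p ≤ 0ℚ → p ≡ 0ℚ
≤-zero 0≤p p≤0 = ≤-antisym p≤0 0≤p

*-cancelʳ-≡ : ∀ {p q} r → r ≢ 0ℚ → p * r ≡ q * r → p ≡ q
*-cancelʳ-≡ {p} {q} r r≢0 pr≡qr = begin
  p                ≡⟨ *-identityʳ p ⟨
  p * 1ℚ           ≡⟨ cong (p *_) (*-inverseʳ r) ⟨
  p * (r * 1/ r)   ≡⟨ *-assoc p r (1/ r) ⟨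
  p * r * 1/ r     ≡⟨ cong (_* 1/ r) pr≡qr ⟩
  q * r * 1/ r     ≡⟨ *-assoc q r (1/ r) ⟩
  q * (r * 1/ r)   ≡⟨ cong (q *_) (*-inverseʳ r) ⟩
  q * 1ℚ           ≡⟨ *-identityʳ q ⟩
  q                ∎
  where
  open ≡-Reasoning
  instance
    r-nonZero : NonZero r
    r-nonZero = ≢-nonZero r≢0

p*q≡0⇒p≡0⊎q≡0 : ∀ p q → p * q ≡ 0ℚ → p ≡ 0ℚ ⊎ q ≡ 0ℚ
p*q≡0⇒p≡0⊎q≡0 p q pq≡0 with q ≟ 0ℚ
... | yes q≡0 = inj₂ q≡0
... | no  q≢0 = inj₁ (*-cancelʳ-≡ q q≢0 (trans pq≡0 (sym (*-zeroˡ q))))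

0≤p*r⇒0≤p : ∀ {p} r → 0ℚ ≤ r → r ≢ 0ℚ → 0ℚ ≤ p * r → 0ℚ ≤ p
0≤p*r⇒0≤p {p} r 0≤r r≢0 0≤pr =
  *-cancelʳ-≤-pos r (subst (_≤ p * r) (sym (*-zeroˡ r)) 0≤pr)
  where
  instance
    r-pos : Positive r
    r-pos = nonNeg∧nonZero⇒pos r {{nonNegative 0≤r}} {{≢-nonZero r≢0}}

-- Division in which 0/0 is 0. The field `value-zero` records this convention, on which `residual`
-- relies when a denominator vanishes.
record Quotient (p m : ℚ) : Set where
  constructor quotient
  field
    value        : ℚ
    value-spec   : value * m ≡ p
    value-zero   : m ≡ 0ℚ → value ≡ 0ℚ
    value-nonNeg : 0ℚ ≤ value

divide : ∀ p m → 0ℚ ≤ p → 0ℚ ≤ m → (m ≡ 0ℚ → p ≡ 0ℚ) → Quotient p m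
divide p m 0≤p 0≤m p-zero with m ≟ 0ℚ
... | yes m≡0 = quotient 0ℚ (trans (*-zeroˡ m) (sym (p-zero m≡0))) (λ _ → refl) ≤-refl
... | no  m≢0 = quotient (p * 1/ m) spec (λ m≡0 → contradiction m≡0 m≢0)
    (0≤p*r⇒0≤p m 0≤m m≢0 (subst (0ℚ ≤_) (sym spec) 0≤p))
  where
  instance
    m-nonZero : NonZero m
    m-nonZero = ≢-nonZero m≢0
  spec : p * 1/ m * m ≡ p
  spec = trans (*-assoc p (1/ m) m) (trans (cong (p *_) (*-inverseˡ m)) (*-identityʳ p))

-- Edge weights on K₄ with prescribed vertex sums

record EdgeWeights (p₀ p₁ p₂ p₃ : ℚ) : Set where
  field
    u₀₁ u₀₂ u₀₃ u₁₂ u₁₃ u₂₃ : ℚ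
    0≤u₀₁ : 0ℚ ≤ u₀₁
    0≤u₀₂ : 0ℚ ≤ u₀₂
    0≤u₀₃ : 0ℚ ≤ u₀₃
    0≤u₁₂ : 0ℚ ≤ u₁₂
    0≤u₁₃ : 0ℚ ≤ u₁₃
    0≤u₂₃ : 0ℚ ≤ u₂₃
    sum₀ : p₀ ≡ u₀₁ + u₀₂ + u₀₃
    sum₁ : p₁ ≡ u₀₁ + u₁₂ + u₁₃
    sum₂ : p₂ ≡ u₀₂ + u₁₂ + u₂₃
    sum₃ : p₃ ≡ u₀₃ + u₁₃ + u₂₃

-- Relabels K₄ by a double transposition. Together with `swap₀₂,₁₃` it generates a Klein four-group,
-- which brings any vertex to position 0.
swap₀₁,₂₃ : ∀ {a b c d} → EdgeWeights a b c d → EdgeWeights b a d c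
swap₀₁,₂₃ U = record
  { 0≤u₀₁ = 0≤u₀₁ ; 0≤u₀₂ = 0≤u₁₃ ; 0≤u₀₃ = 0≤u₁₂
  ; 0≤u₁₂ = 0≤u₀₃ ; 0≤u₁₃ = 0≤u₀₂ ; 0≤u₂₃ = 0≤u₂₃
  ; sum₀ = trans sum₁ (swapʳ u₀₁ u₁₂ u₁₃) ; sum₁ = trans sum₀ (swapʳ u₀₁ u₀₂ u₀₃)
  ; sum₂ = trans sum₃ (swapˡ u₀₃ u₁₃ u₂₃) ; sum₃ = trans sum₂ (swapˡ u₀₂ u₁₂ u₂₃)
  }
  where
  open EdgeWeights U
  swapʳ : ∀ x y z → x + y + z ≡ x + z + y
  swapʳ = solve 3 (λ x y z → x :+ y :+ z := x :+ z :+ y) refl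
  swapˡ : ∀ x y z → x + y + z ≡ y + x + z
  swapˡ = solve 3 (λ x y z → x :+ y :+ z := y :+ x :+ z) refl

swap₀₂,₁₃ : ∀ {a b c d} → EdgeWeights a b c d → EdgeWeights c d a b
swap₀₂,₁₃ U = record
  { 0≤u₀₁ = 0≤u₂₃ ; 0≤u₀₂ = 0≤u₀₂ ; 0≤u₀₃ = 0≤u₁₂
  ; 0≤u₁₂ = 0≤u₀₃ ; 0≤u₁₃ = 0≤u₁₃ ; 0≤u₂₃ = 0≤u₀₁
  ; sum₀ = trans sum₂ (rotʳ u₀₂ u₁₂ u₂₃) ; sum₁ = trans sum₃ (rotʳ u₀₃ u₁₃ u₂₃)
  ; sum₂ = trans sum₀ (rotˡ u₀₁ u₀₂ u₀₃) ; sum₃ = trans sum₁ (rotˡ u₀₁ u₁₂ u₁₃)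
  }
  where
  open EdgeWeights U
  rotʳ : ∀ x y z → x + y + z ≡ z + x + y
  rotʳ = solve 3 (λ x y z → x :+ y :+ z := z :+ x :+ y) refl
  rotˡ : ∀ x y z → x + y + z ≡ y + z + x
  rotˡ = solve 3 (λ x y z → x :+ y :+ z := y :+ z :+ x) refl

-- With u₁₃ = u₂₃ = 0 the sum at vertex 3 forces u₀₃ = d. What remains is a triangle with vertex
-- sums a - d, b, c, whose edge weights are half of two sums minus the third; the three inequalities
-- are their nonnegativity.
edgeWeights-heavyFirst : ∀ {a b c d} → 0ℚ ≤ d → a ≤ b + c + d → c + d ≤ a + b → b + d ≤ a + c →
                         EdgeWeights a b c d
edgeWeights-heavyFirst {a} {b} {c} {d} 0≤d a≤b+c+d c+d≤a+b b+d≤a+c = record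
  { 0≤u₀₁ = 0≤½* (≤⇒0≤- c+d≤a+b)
  ; 0≤u₀₂ = 0≤½* (≤⇒0≤- b+d≤a+c)
  ; 0≤u₀₃ = 0≤d
  ; 0≤u₁₂ = 0≤½* (≤⇒0≤- a≤b+c+d)
  ; 0≤u₁₃ = ≤-refl
  ; 0≤u₂₃ = ≤-refl
  ; sum₀ = solve 4 (λ a b c d → a :=
      con ½ :* (a :+ b :- (c :+ d)) :+ con ½ :* (a :+ c :- (b :+ d)) :+ d) refl a b c d
  ; sum₁ = solve 4 (λ a b c d → b :=
      con ½ :* (a :+ b :- (c :+ d)) :+ con ½ :* (b :+ c :+ d :- a) :+ con 0ℚ) refl a b c d
  ; sum₂ = solve 4 (λ a b c d → c :=
      con ½ :* (a :+ c :- (b :+ d)) :+ con ½ :* (b :+ c :+ d :- a) :+ con 0ℚ) refl a b c d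
  ; sum₃ = solve 1 (λ d → d := d :+ con 0ℚ :+ con 0ℚ) refl d
  }

≤-respects-+-comm : ∀ p q r s → p + q ≤ r + s → q + p ≤ s + r
≤-respects-+-comm p q r s p+q≤r+s rewrite +-comm q p | +-comm s r = p+q≤r+s

-- The two comparisons single out a vertex heavy enough to be adjacent to all the edges of
-- positive weight but one.
edgeWeights : ∀ {p₀ p₁ p₂ p₃} → 0ℚ ≤ p₀ → 0ℚ ≤ p₁ → 0ℚ ≤ p₂ → 0ℚ ≤ p₃ →
              p₀ ≤ p₁ + p₂ + p₃ → p₁ ≤ p₀ + p₃ + p₂ → p₂ ≤ p₃ + p₀ + p₁ → p₃ ≤ p₂ + p₁ + p₀ →
              EdgeWeights p₀ p₁ p₂ p₃
edgeWeights {p₀} {p₁} {p₂} {p₃} 0≤p₀ 0≤p₁ 0≤p₂ 0≤p₃ ineq₀ ineq₁ ineq₂ ineq₃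
  with ≤-total (p₂ + p₃) (p₀ + p₁) | ≤-total (p₁ + p₃) (p₀ + p₂)
... | inj₁ q | inj₁ r = edgeWeights-heavyFirst 0≤p₃ ineq₀ q r
... | inj₁ q | inj₂ r = swap₀₁,₂₃ (edgeWeights-heavyFirst 0≤p₂ ineq₁
  (≤-respects-+-comm p₂ p₃ p₀ p₁ q) r)
... | inj₂ q | inj₁ r = swap₀₂,₁₃ (edgeWeights-heavyFirst 0≤p₁ ineq₂
  q (≤-respects-+-comm p₁ p₃ p₀ p₂ r))
... | inj₂ q | inj₂ r = swap₀₁,₂₃ (swap₀₂,₁₃ (edgeWeights-heavyFirst 0≤p₀ ineq₃
  (≤-respects-+-comm p₀ p₁ p₂ p₃ q) (≤-respects-+-comm p₀ p₂ p₁ p₃ r)))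

-- Weighted counts of matchings

Σℚ-cong : (xs : List X) {f g : X → ℚ} → f ≗ g → Σℚ xs f ≡ Σℚ xs g
Σℚ-cong []       f≗g = refl
Σℚ-cong (x ∷ xs) f≗g = cong₂ _+_ (f≗g x) (Σℚ-cong xs f≗g)

Σℚ-++ : (xs ys : List X) (f : X → ℚ) → Σℚ (xs ++ ys) f ≡ Σℚ xs f + Σℚ ys f
Σℚ-++ []       ys f = sym (+-identityˡ (Σℚ ys f))
Σℚ-++ (x ∷ xs) ys f = trans (cong (f x +_) (Σℚ-++ xs ys f)) (sym (+-assoc (f x) _ _))

Σℚ-map : (g : X → Y) (xs : List X) (f : Y → ℚ) → Σℚ (map g xs) f ≡ Σℚ xs (f ∘ g)
Σℚ-map g []       f = refl
Σℚ-map g (x ∷ xs) f = cong (f (g x) +_) (Σℚ-map g xs f)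

Σℚ-+ : (xs : List X) (f g : X → ℚ) → Σℚ xs (λ x → f x + g x) ≡ Σℚ xs f + Σℚ xs g
Σℚ-+ []       f g = refl
Σℚ-+ (x ∷ xs) f g = trans (cong (f x + g x +_) (Σℚ-+ xs f g))
  (solve 4 (λ a b c d → a :+ b :+ (c :+ d) := a :+ c :+ (b :+ d)) refl (f x) (g x) _ _)

Σℚ-*ˡ : (xs : List X) (c : ℚ) (f : X → ℚ) → Σℚ xs (λ x → c * f x) ≡ c * Σℚ xs f
Σℚ-*ˡ []       c f = sym (*-zeroʳ c)
Σℚ-*ˡ (x ∷ xs) c f = trans (cong (c * f x +_) (Σℚ-*ˡ xs c f)) (sym (*-distribˡ-+ c (f x) _))

Σℚ-mono : (xs : List X) {f g : X → ℚ} → (∀ x → f x ≤ g x) → Σℚ xs f ≤ Σℚ xs g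
Σℚ-mono []       f≤g = ≤-refl
Σℚ-mono (x ∷ xs) f≤g = +-mono-≤ (f≤g x) (Σℚ-mono xs f≤g)

Πᶠ : ∀ k → (Fin k → ℚ) → ℚ
Πᶠ zero    f = 1ℚ
Πᶠ (suc k) f = f zero * Πᶠ k (f ∘ suc)

Πᶠ-cong : ∀ k {f g : Fin k → ℚ} → f ≗ g → Πᶠ k f ≡ Πᶠ k g
Πᶠ-cong zero    f≗g = refl
Πᶠ-cong (suc k) f≗g = cong₂ _*_ (f≗g zero) (Πᶠ-cong k (f≗g ∘ suc))

Πᶠ-* : ∀ k (f g : Fin k → ℚ) → Πᶠ k f * Πᶠ k g ≡ Πᶠ k (λ v → f v * g v)
Πᶠ-* zero    f g = refl
Πᶠ-* (suc k) f g = trans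
  (solve 4 (λ a b c d → a :* b :* (c :* d) := a :* c :* (b :* d)) refl (f zero) _ (g zero) _)
  (cong (f zero * g zero *_) (Πᶠ-* k (f ∘ suc) (g ∘ suc)))

p≡0⇒p*q≡0 : ∀ {p} q → p ≡ 0ℚ → p * q ≡ 0ℚ
p≡0⇒p*q≡0 q refl = *-zeroˡ q

q≡0⇒p*q≡0 : ∀ p {q} → q ≡ 0ℚ → p * q ≡ 0ℚ
q≡0⇒p*q≡0 p refl = *-zeroʳ p

Πᶠ-zero : ∀ k (f : Fin k → ℚ) v → f v ≡ 0ℚ → Πᶠ k f ≡ 0ℚ
Πᶠ-zero (suc k) f zero    fv≡0 = p≡0⇒p*q≡0 (Πᶠ k (f ∘ suc)) fv≡0
Πᶠ-zero (suc k) f (suc v) fv≡0 = q≡0⇒p*q≡0 (f zero) (Πᶠ-zero k (f ∘ suc) v fv≡0)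

0≤Πᶠ : ∀ k {f : Fin k → ℚ} → (∀ v → 0ℚ ≤ f v) → 0ℚ ≤ Πᶠ k f
0≤Πᶠ zero    0≤f = nonNegative⁻¹ 1ℚ
0≤Πᶠ (suc k) 0≤f = 0≤* (0≤f zero) (0≤Πᶠ k (0≤f ∘ suc))

-- Two paired incidences may belong to one vertex, so loops and parallel edges occur. A loop adds
-- two to the degree of its vertex.
record Edge (k : ℕ) : Set where
  constructor edge
  field
    end₁ end₂ : Fin k
    weight    : ℚ

open Edge

ind : Fin k → Fin k → ℕ
ind t v = if does (t Fin.≟ v) then 1 else 0

addEdge : Edge k → (Fin k → ℕ) → Fin k → ℕ
addEdge e u v = ind (end₁ e) v ℕ.+ ind (end₂ e) v ℕ.+ u v

-- One factor per vertex combines the fugacity at degree 0 with the vanishing at degree 2 or more.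
-- The weight of a configuration is thus a plain product, indifferent to exchanging factors vertex
-- by vertex.
vertexWeight : ℚ → ℕ → ℚ
vertexWeight λᵥ 0             = λᵥ
vertexWeight λᵥ 1             = 1ℚ
vertexWeight λᵥ (suc (suc _)) = 0ℚ

vertexWeight-≥2 : ∀ λᵥ {m} → 2 ℕ.≤ m → vertexWeight λᵥ m ≡ 0ℚ
vertexWeight-≥2 λᵥ (s≤s (s≤s _)) = refl

0≤vertexWeight : ∀ {λᵥ} m → 0ℚ ≤ λᵥ → 0ℚ ≤ vertexWeight λᵥ m
0≤vertexWeight 0             0≤λ = 0≤λ
0≤vertexWeight 1             _   = nonNegative⁻¹ 1ℚ
0≤vertexWeight (suc (suc _)) _   = ≤-refl

3≤+⇒2≤ : ∀ m {n} → 3 ℕ.≤ m ℕ.+ n → 2 ℕ.≤ m ⊎ 2 ℕ.≤ n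
3≤+⇒2≤ 0             3≤n       = inj₂ (ℕ.<⇒≤ 3≤n)
3≤+⇒2≤ 1             (s≤s 2≤n) = inj₂ 2≤n
3≤+⇒2≤ (suc (suc m)) _         = inj₁ (s≤s (s≤s z≤n))

-- Exchanging two degree functions on a set of vertices

module _ {k : ℕ} where

  addEdge-cong : ∀ e {u u′ : Fin k → ℕ} → u ≗ u′ → addEdge e u ≗ addEdge e u′
  addEdge-cong e u≗u′ v = cong (ind (end₁ e) v ℕ.+ ind (end₂ e) v ℕ.+_) (u≗u′ v)

  mix : (Fin k → Bool) → (Fin k → ℕ) → (Fin k → ℕ) → Fin k → ℕ
  mix s u u′ v = if s v then u′ v else u v

  -- The labels have arbitrary type because the notion serves twice: for component labels, and for
  -- the Boolean indicator of the exchanged set.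
  Respects : {X : Set} → (Fin k → X) → (es : List (Edge k)) → Vec Bool (length es) → Set
  Respects s []       _           = Unit
  Respects s (e ∷ es) (true  ∷ d) = s (end₁ e) ≡ s (end₂ e) × Respects s es d
  Respects s (e ∷ es) (false ∷ d) = Respects s es d

  ind-0 : ∀ {s : Fin k → Bool} {b : Bool} {t v} → s t ≡ b → s v ≡ not b → ind t v ≡ 0
  ind-0 {t = t} {v} st sv with t Fin.≟ v
  ... | no  _    = refl
  ind-0 {b = true}  st sv | yes refl = contradiction (trans (sym st) sv) λ ()
  ind-0 {b = false} st sv | yes refl = contradiction (trans (sym st) sv) λ ()

  addEdge-outside : ∀ (s : Fin k → Bool) {b} e u v → s (end₁ e) ≡ b → s (end₂ e) ≡ b → s v ≡ not b →
                    addEdge e u v ≡ u v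
  addEdge-outside s e u v s₁ s₂ sv =
    cong₂ (λ m n → m ℕ.+ n ℕ.+ u v) (ind-0 {s} s₁ sv) (ind-0 {s} s₂ sv)

  mix-addEdge : ∀ s e u u′ → addEdge e (mix s u u′) ≗ mix s (addEdge e u) (addEdge e u′)
  mix-addEdge s e u u′ v with s v
  ... | true  = refl
  ... | false = refl

  -- The four lemmas from here on follow a single edge through the exchange: with its ends outside
  -- `s` it stays on its side, with its ends inside it passes to the other side.
  mix-addEdge-unswappedˡ : ∀ s e u u′ → s (end₁ e) ≡ false → s (end₂ e) ≡ false →
                     mix s (addEdge e u) u′ ≗ addEdge e (mix s u u′)
  mix-addEdge-unswappedˡ s e u u′ s₁ s₂ v with s v in sv
  ... | true  = sym (addEdge-outside s e u′ v s₁ s₂ sv)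
  ... | false = refl

  mix-addEdge-unswappedʳ : ∀ s e u u′ → s (end₁ e) ≡ false → s (end₂ e) ≡ false →
                      mix s u (addEdge e u′) ≗ mix s u u′
  mix-addEdge-unswappedʳ s e u u′ s₁ s₂ v with s v in sv
  ... | true  = addEdge-outside s e u′ v s₁ s₂ sv
  ... | false = refl

  mix-addEdge-swappedˡ : ∀ s e u u′ → s (end₁ e) ≡ true → s (end₂ e) ≡ true →
                     mix s (addEdge e u) u′ ≗ mix s u u′
  mix-addEdge-swappedˡ s e u u′ s₁ s₂ v with s v in sv
  ... | true  = refl
  ... | false = addEdge-outside s e u v s₁ s₂ sv

  mix-addEdge-swappedʳ : ∀ s e u u′ → s (end₁ e) ≡ true → s (end₂ e) ≡ true →
                      mix s u (addEdge e u′) ≗ addEdge e (mix s u u′)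
  mix-addEdge-swappedʳ s e u u′ s₁ s₂ v with s v in sv
  ... | true  = refl
  ... | false = sym (addEdge-outside s e u v s₁ s₂ sv)

  -- Components of a set of edges by contraction

  multiplicity : {X : Set} → (X → Fin k) → Fin k → List X → ℕ
  multiplicity c ℓ []       = 0
  multiplicity c ℓ (x ∷ xs) = ind (c x) ℓ ℕ.+ multiplicity c ℓ xs

  -- The accumulator `ts` is meant for the terminals: they are counted along with the edge ends and
  -- are all that is left after every edge has been contracted.
  ends : (es : List (Edge k)) → Vec Bool (length es) → List (Fin k) → List (Fin k)
  ends []       _           ts = ts
  ends (e ∷ es) (true  ∷ d) ts = end₁ e ∷ end₂ e ∷ ends es d ts
  ends (e ∷ es) (false ∷ d) ts = ends es d ts

  multiplicity-ends : ∀ (c : Fin k → Fin k) ℓ es d ts →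
    multiplicity c ℓ (ends es d ts) ≡ multiplicity c ℓ (ends es d []) ℕ.+ multiplicity c ℓ ts
  multiplicity-ends c ℓ []       _           ts = refl
  multiplicity-ends c ℓ (e ∷ es) (true  ∷ d) ts = trans
    (cong (λ m → a ℕ.+ (b ℕ.+ m)) (multiplicity-ends c ℓ es d ts))
    (trans (cong (a ℕ.+_) (sym (ℕ.+-assoc b _ _))) (sym (ℕ.+-assoc a _ _)))
    where
    a = ind (c (end₁ e)) ℓ
    b = ind (c (end₂ e)) ℓ
  multiplicity-ends c ℓ (e ∷ es) (false ∷ d) ts = multiplicity-ends c ℓ es d ts

  ind-refl : ∀ (v : Fin k) → ind v v ≡ 1
  ind-refl v = cong (if_then 1 else 0) (dec-true (v Fin.≟ v) refl)

  ind-≢ : ∀ {t v : Fin k} → t ≢ v → ind t v ≡ 0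
  ind-≢ {t} {v} t≢v with t Fin.≟ v
  ... | yes t≡v = contradiction t≡v t≢v
  ... | no  _   = refl

  -- The union step of union-find: the class of `a` takes over the label of `b`.
  merge : (Fin k → Fin k) → Fin k → Fin k → Fin k → Fin k
  merge c a b x = if does (c x Fin.≟ c a) then c b else c x

  merge-≡ : ∀ c a b {x y} → c x ≡ c y → merge c a b x ≡ merge c a b y
  merge-≡ c a b = cong (λ z → if does (z Fin.≟ c a) then c b else z)

  merge-ends : ∀ c a b → merge c a b a ≡ merge c a b b
  merge-ends c a b rewrite dec-true (c a Fin.≟ c a) refl with c b Fin.≟ c a
  ... | yes _ = refl
  ... | no  _ = refl

  ind-merge-≢ : ∀ c a b {ℓ} → ℓ ≢ c b → ∀ x → ind (merge c a b x) ℓ ℕ.≤ ind (c x) ℓ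
  ind-merge-≢ c a b {ℓ} ℓ≢ x with c x Fin.≟ c a
  ... | no  _ = ℕ.≤-refl
  ... | yes _ rewrite ind-≢ (ℓ≢ ∘ sym) = z≤n

  ind-merge-same : ∀ c a b {ℓ} → c a ≡ c b → ∀ x → ind (merge c a b x) ℓ ℕ.≤ ind (c x) ℓ
  ind-merge-same c a b ca≡cb x with c x Fin.≟ c a
  ... | no  _     = ℕ.≤-refl
  ... | yes cx≡ca = ℕ.≤-reflexive (cong (λ z → ind z _) (sym (trans cx≡ca ca≡cb)))

  ind-merge : ∀ c a b x → ind (merge c a b x) (c b) ℕ.≤ ind (c x) (c a) ℕ.+ ind (c x) (c b)
  ind-merge c a b x with c x Fin.≟ c a
  ... | no  _ = ℕ.≤-refl
  ... | yes _ rewrite ind-refl (c b) = s≤s z≤n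

  multiplicity-mono : ∀ (c c′ : Fin k → Fin k) ℓ → (∀ x → ind (c′ x) ℓ ℕ.≤ ind (c x) ℓ) →
                      ∀ xs → multiplicity c′ ℓ xs ℕ.≤ multiplicity c ℓ xs
  multiplicity-mono c c′ ℓ c′≤c []       = z≤n
  multiplicity-mono c c′ ℓ c′≤c (x ∷ xs) = ℕ.+-mono-≤ (c′≤c x) (multiplicity-mono c c′ ℓ c′≤c xs)

  multiplicity-merge : ∀ c a b xs → multiplicity (merge c a b) (c b) xs ℕ.≤
                                    multiplicity c (c a) xs ℕ.+ multiplicity c (c b) xs
  multiplicity-merge c a b []       = z≤n
  multiplicity-merge c a b (x ∷ xs) = ℕ.≤-trans
    (ℕ.+-mono-≤ (ind-merge c a b x) (multiplicity-merge c a b xs))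
    (ℕ.≤-reflexive (solveℕ 4 (λ p q r s → p ⊹ q ⊹ (r ⊹ s) ≐ p ⊹ r ⊹ (q ⊹ s)) refl
      (ind (c x) (c a)) (ind (c x) (c b)) (multiplicity c (c a) xs) (multiplicity c (c b) xs)))
    where
    open ℕ.+-*-Solver using () renaming (solve to solveℕ; _:+_ to _⊹_; _:=_ to _≐_)

  AtMostTwice : (Fin k → Fin k) → List (Fin k) → Set
  AtMostTwice c xs = ∀ ℓ → multiplicity c ℓ xs ℕ.≤ 2

  -- Contracting an edge: its two ends are no longer counted, so that the merged class again
  -- has at most (2 - 1) + (2 - 1) members.
  merge-atMostTwice : ∀ c a b xs → AtMostTwice c (a ∷ b ∷ xs) → AtMostTwice (merge c a b) xs
  merge-atMostTwice c a b xs ≤2 ℓ with ℓ Fin.≟ c b | c a Fin.≟ c b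
  ... | no ℓ≢cb | _ = ℕ.≤-trans
    (multiplicity-mono c (merge c a b) ℓ (ind-merge-≢ c a b ℓ≢cb) xs)
    (ℕ.≤-trans (ℕ.m≤n+m _ _) (ℕ.≤-trans (ℕ.m≤n+m _ (ind (c a) ℓ)) (≤2 ℓ)))
  ... | yes refl | yes ca≡cb = ℕ.≤-trans
    (multiplicity-mono c (merge c a b) (c b) (ind-merge-same c a b ca≡cb) xs)
    (ℕ.≤-trans (ℕ.m≤n+m _ _) (ℕ.≤-trans (ℕ.m≤n+m _ (ind (c a) (c b))) (≤2 (c b))))
  ... | yes refl | no _ = ℕ.≤-trans (multiplicity-merge c a b xs) (ℕ.+-mono-≤
    (ℕ.≤-pred (ℕ.≤-trans (ℕ.≤-trans (ℕ.+-monoʳ-≤ 1 (ℕ.m≤n+m _ (ind (c b) (c a))))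
      (ℕ.≤-reflexive (cong (ℕ._+ (ind (c b) (c a) ℕ.+ multiplicity c (c a) xs)) (sym (ind-refl (c a))))))
      (≤2 (c a))))
    (ℕ.≤-pred (ℕ.≤-trans (ℕ.≤-trans
      (ℕ.≤-reflexive (cong (ℕ._+ multiplicity c (c b) xs) (sym (ind-refl (c b)))))
      (ℕ.m≤n+m _ (ind (c a) (c b)))) (≤2 (c b)))))

  -- Contracts the edges of `d` in turn, each time passing the bound on to the shorter list. The
  -- middle clause, that labels only get coarser, ensures that an edge contracted early still has
  -- equal labels at its ends after the later merges.
  components : ∀ es d ts c → AtMostTwice c (ends es d ts) →
    Σ[ c′ ∈ (Fin k → Fin k) ]
      (Respects c′ es d × (∀ {x y} → c x ≡ c y → c′ x ≡ c′ y) × AtMostTwice c′ ts)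
  components []       _           ts c ≤2 = c , tt , id , ≤2
  components (e ∷ es) (false ∷ d) ts c ≤2 = components es d ts c ≤2
  components (e ∷ es) (true  ∷ d) ts c ≤2
    with components es d ts (merge c (end₁ e) (end₂ e))
           (merge-atMostTwice c (end₁ e) (end₂ e) (ends es d ts) ≤2)
  ... | c′ , c′-es , coarser , ≤2′ =
    c′ , (coarser (merge-ends c (end₁ e) (end₂ e)) , c′-es)
       , coarser ∘ merge-≡ c (end₁ e) (end₂ e) , ≤2′

  Respects-∘ : ∀ {X Y : Set} (f : X → Y) {c : Fin k → X} es d → Respects c es d → Respects (f ∘ c) es d
  Respects-∘ f []       _           _            = tt
  Respects-∘ f (e ∷ es) (true  ∷ d) (c-e , c-es) = cong f c-e , Respects-∘ f es d c-es
  Respects-∘ f (e ∷ es) (false ∷ d) c-es         = Respects-∘ f es d c-es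

-- Pairs of edge sets grouped by their symmetric difference

module Matchings {k : ℕ} (fug : Fin k → ℚ) where

  configWeight : (Fin k → ℕ) → ℚ
  configWeight u = Πᶠ k (λ v → vertexWeight (fug v) (u v))

  -- The weighted count of edge subsets, where u is the degree already present at each vertex.
  count : (Fin k → ℕ) → List (Edge k) → ℚ
  count u []       = configWeight u
  count u (e ∷ es) = weight e * count (addEdge e u) es + count u es

  configWeight-cong : ∀ {u u′} → u ≗ u′ → configWeight u ≡ configWeight u′
  configWeight-cong u≗u′ = Πᶠ-cong k (λ v → cong (vertexWeight (fug v)) (u≗u′ v))

  count-cong : ∀ es {u u′} → u ≗ u′ → count u es ≡ count u′ es
  count-cong []       u≗u′ = configWeight-cong u≗u′
  count-cong (e ∷ es) u≗u′ = cong₂ _+_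
    (cong (weight e *_) (count-cong es (addEdge-cong e u≗u′))) (count-cong es u≗u′)

  -- The part of count u es * count u′ es coming from the pairs of edge subsets whose symmetric
  -- difference is d.
  pairCount : (es : List (Edge k)) → Vec Bool (length es) → (Fin k → ℕ) → (Fin k → ℕ) → ℚ
  pairCount []       _           u u′ = configWeight u * configWeight u′
  pairCount (e ∷ es) (true  ∷ d) u u′ =
    weight e * (pairCount es d (addEdge e u) u′ + pairCount es d u (addEdge e u′))
  pairCount (e ∷ es) (false ∷ d) u u′ =
    weight e * weight e * pairCount es d (addEdge e u) (addEdge e u′) + pairCount es d u u′

  count-* : ∀ es u u′ →
            count u es * count u′ es ≡ Σℚ (subsets (length es)) (λ d → pairCount es d u u′)
  count-* []       u u′ = sym (+-identityʳ _)
  count-* (e ∷ es) u u′ = sym (begin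
    Σℚ (map (true ∷_) ds ++ map (false ∷_) ds) T
      ≡⟨ Σℚ-++ (map (true ∷_) ds) (map (false ∷_) ds) T ⟩
    Σℚ (map (true ∷_) ds) T + Σℚ (map (false ∷_) ds) T
      ≡⟨ cong₂ _+_ (Σℚ-map (true ∷_) ds T) (Σℚ-map (false ∷_) ds T) ⟩
    Σℚ ds (λ d → w * (T₁₀ d + T₀₁ d)) + Σℚ ds (λ d → w * w * T₁₁ d + T₀₀ d)
      ≡⟨ cong₂ _+_
           (trans (Σℚ-*ˡ ds w (λ d → T₁₀ d + T₀₁ d)) (cong (w *_) (Σℚ-+ ds T₁₀ T₀₁)))
           (trans (Σℚ-+ ds (λ d → w * w * T₁₁ d) T₀₀) (cong (_+ Σℚ ds T₀₀) (Σℚ-*ˡ ds (w * w) T₁₁))) ⟩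
    w * (Σℚ ds T₁₀ + Σℚ ds T₀₁) + (w * w * Σℚ ds T₁₁ + Σℚ ds T₀₀)
      ≡⟨ cong₂ (λ p q → w * p + q)
           (cong₂ _+_ (count-* es (addEdge e u) u′) (count-* es u (addEdge e u′)))
           (cong₂ (λ p q → w * w * p + q)
             (count-* es (addEdge e u) (addEdge e u′)) (count-* es u u′)) ⟨
    w * (a₁ * a₀′ + a₀ * a₁′) + (w * w * (a₁ * a₁′) + a₀ * a₀′)
      ≡⟨ solve 5 (λ w a₁ a₀ a₁′ a₀′ →
           w :* (a₁ :* a₀′ :+ a₀ :* a₁′) :+ (w :* w :* (a₁ :* a₁′) :+ a₀ :* a₀′) :=
           (w :* a₁ :+ a₀) :* (w :* a₁′ :+ a₀′)) refl w a₁ a₀ a₁′ a₀′ ⟩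
    (w * a₁ + a₀) * (w * a₁′ + a₀′) ∎)
    where
    open ≡-Reasoning
    w  = weight e
    ds = subsets (length es)
    a₁ = count (addEdge e u) es
    a₀ = count u es
    a₁′ = count (addEdge e u′) es
    a₀′ = count u′ es
    T : Vec Bool (suc (length es)) → ℚ
    T d = pairCount (e ∷ es) d u u′
    T₁₁ T₁₀ T₀₁ T₀₀ : Vec Bool (length es) → ℚ
    T₁₁ d = pairCount es d (addEdge e u) (addEdge e u′)
    T₁₀ d = pairCount es d (addEdge e u) u′
    T₀₁ d = pairCount es d u (addEdge e u′)
    T₀₀ d = pairCount es d u u′

  pairCount-cong : ∀ es d {u₁ u₂ u₁′ u₂′} → u₁ ≗ u₂ → u₁′ ≗ u₂′ →
                   pairCount es d u₁ u₁′ ≡ pairCount es d u₂ u₂′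
  pairCount-cong []       _           p q = cong₂ _*_ (configWeight-cong p) (configWeight-cong q)
  pairCount-cong (e ∷ es) (true  ∷ d) p q = cong (weight e *_)
    (cong₂ _+_ (pairCount-cong es d (addEdge-cong e p) q) (pairCount-cong es d p (addEdge-cong e q)))
  pairCount-cong (e ∷ es) (false ∷ d) p q = cong₂ _+_
    (cong (weight e * weight e *_) (pairCount-cong es d (addEdge-cong e p) (addEdge-cong e q)))
    (pairCount-cong es d p q)

  0≤pairCount : (∀ v → 0ℚ ≤ fug v) → ∀ {es} → All (λ e → 0ℚ ≤ weight e) es →
                ∀ d u u′ → 0ℚ ≤ pairCount es d u u′
  0≤pairCount 0≤fug []           _           u u′ =
    0≤* (0≤Πᶠ k (λ v → 0≤vertexWeight (u v) (0≤fug v))) (0≤Πᶠ k (λ v → 0≤vertexWeight (u′ v) (0≤fug v)))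
  0≤pairCount 0≤fug (0≤w ∷ 0≤ws) (true  ∷ d) u u′ =
    0≤* 0≤w (0≤+ (0≤pairCount 0≤fug 0≤ws d _ u′) (0≤pairCount 0≤fug 0≤ws d u _))
  0≤pairCount 0≤fug (0≤w ∷ 0≤ws) (false ∷ d) u u′ =
    0≤+ (0≤* (0≤* 0≤w 0≤w) (0≤pairCount 0≤fug 0≤ws d _ _)) (0≤pairCount 0≤fug 0≤ws d u u′)

  configWeight-mix : ∀ s u u′ →
    configWeight u * configWeight u′ ≡ configWeight (mix s u u′) * configWeight (mix s u′ u)
  configWeight-mix s u u′ =
    trans (Πᶠ-* k _ _) (trans (Πᶠ-cong k pointwise) (sym (Πᶠ-* k _ _)))
    where
    pointwise : ∀ v → vertexWeight (fug v) (u v) * vertexWeight (fug v) (u′ v) ≡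
                      vertexWeight (fug v) (mix s u u′ v) * vertexWeight (fug v) (mix s u′ u v)
    pointwise v with s v
    ... | true  = *-comm (vertexWeight (fug v) (u v)) _
    ... | false = refl

  -- An edge of `d` lies in exactly one of the two sets and is wholly inside or wholly outside `s`;
  -- if inside, the two summands trade places. A shared edge raises both degree functions alike, so
  -- `s` may cut through it.
  pairCount-mix : ∀ s es d u u′ → Respects s es d →
                  pairCount es d u u′ ≡ pairCount es d (mix s u u′) (mix s u′ u)
  pairCount-mix s []       _           u u′ _ = configWeight-mix s u u′
  pairCount-mix s (e ∷ es) (true ∷ d)  u u′ (s-e , s-es) with s (end₂ e) in s₂
  ... | false = cong (weight e *_) (cong₂ _+_
    (trans (pairCount-mix s es d (addEdge e u) u′ s-es)
      (pairCount-cong es d (mix-addEdge-unswappedˡ s e u u′ s-e s₂) (mix-addEdge-unswappedʳ s e u′ u s-e s₂)))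
    (trans (pairCount-mix s es d u (addEdge e u′) s-es)
      (pairCount-cong es d (mix-addEdge-unswappedʳ s e u u′ s-e s₂) (mix-addEdge-unswappedˡ s e u′ u s-e s₂))))
  ... | true  = cong (weight e *_) (trans (+-comm (pairCount es d (addEdge e u) u′) _) (cong₂ _+_
    (trans (pairCount-mix s es d u (addEdge e u′) s-es)
      (pairCount-cong es d (mix-addEdge-swappedʳ s e u u′ s-e s₂) (mix-addEdge-swappedˡ s e u′ u s-e s₂)))
    (trans (pairCount-mix s es d (addEdge e u) u′ s-es)
      (pairCount-cong es d (mix-addEdge-swappedˡ s e u u′ s-e s₂) (mix-addEdge-swappedʳ s e u′ u s-e s₂)))))
  pairCount-mix s (e ∷ es) (false ∷ d) u u′ s-es = cong₂ _+_
    (cong (weight e * weight e *_) (trans (pairCount-mix s es d _ _ s-es)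
      (pairCount-cong es d (sym ∘ mix-addEdge s e u u′) (sym ∘ mix-addEdge s e u′ u))))
    (pairCount-mix s es d u u′ s-es)

  configWeight-≥2 : ∀ u v → 2 ℕ.≤ u v → configWeight u ≡ 0ℚ
  configWeight-≥2 u v 2≤uv = Πᶠ-zero k (λ v → vertexWeight (fug v) (u v)) v (vertexWeight-≥2 (fug v) 2≤uv)

  -- However the edges of `d` are split between the two sets, three ends at `v` give one of the sets
  -- degree at least two there. Shared edges only raise the degrees.
  pairCount-zero : ∀ es d u u′ v → 3 ℕ.≤ multiplicity id v (ends es d []) ℕ.+ (u v ℕ.+ u′ v) →
                   pairCount es d u u′ ≡ 0ℚ
  pairCount-zero []       _           u u′ v 3≤ with 3≤+⇒2≤ (u v) 3≤
  ... | inj₁ 2≤u  = p≡0⇒p*q≡0 (configWeight u′) (configWeight-≥2 u v 2≤u)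
  ... | inj₂ 2≤u′ = q≡0⇒p*q≡0 (configWeight u) (configWeight-≥2 u′ v 2≤u′)
  pairCount-zero (e ∷ es) (true ∷ d)  u u′ v 3≤ = trans (cong (weight e *_) (cong₂ _+_
      (pairCount-zero es d _ _ v (subst (3 ℕ.≤_) eq₁ 3≤))
      (pairCount-zero es d _ _ v (subst (3 ℕ.≤_) eq₂ 3≤))))
    (*-zeroʳ (weight e))
    where
    open ℕ.+-*-Solver using () renaming (solve to solveℕ; _:+_ to _⊹_; _:=_ to _≐_)
    m = multiplicity id v (ends es d [])
    a = ind (end₁ e) v
    b = ind (end₂ e) v
    eq₁ : a ℕ.+ (b ℕ.+ m) ℕ.+ (u v ℕ.+ u′ v) ≡ m ℕ.+ (a ℕ.+ b ℕ.+ u v ℕ.+ u′ v)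
    eq₁ = solveℕ 5 (λ a b m x y → a ⊹ (b ⊹ m) ⊹ (x ⊹ y) ≐ m ⊹ (a ⊹ b ⊹ x ⊹ y)) refl a b m (u v) (u′ v)
    eq₂ : a ℕ.+ (b ℕ.+ m) ℕ.+ (u v ℕ.+ u′ v) ≡ m ℕ.+ (u v ℕ.+ (a ℕ.+ b ℕ.+ u′ v))
    eq₂ = solveℕ 5 (λ a b m x y → a ⊹ (b ⊹ m) ⊹ (x ⊹ y) ≐ m ⊹ (x ⊹ (a ⊹ b ⊹ y))) refl a b m (u v) (u′ v)
  pairCount-zero (e ∷ es) (false ∷ d) u u′ v 3≤ = trans (cong₂ _+_
      (trans (cong (weight e * weight e *_) (pairCount-zero es d _ _ v (ℕ.≤-trans 3≤
        (ℕ.+-monoʳ-≤ (multiplicity id v (ends es d []))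
          (ℕ.+-mono-≤ (ℕ.m≤n+m (u v) δ) (ℕ.m≤n+m (u′ v) δ))))))
        (*-zeroʳ (weight e * weight e)))
      (pairCount-zero es d u u′ v 3≤))
    (+-identityˡ 0ℚ)
    where
    δ = ind (end₁ e) v ℕ.+ ind (end₂ e) v

-- Graphs with three terminals

bit : Bool → ℕ → ℕ
bit x m = if x then m else 0

bit-0 : ∀ x → bit x 0 ≡ 0
bit-0 true  = refl
bit-0 false = refl

-- A circuit with its incidences forgotten: an external edge survives only as the vertex carrying
-- it, and the three vertices may coincide.
record Graph : Set where
  field
    #V         : ℕ
    fug        : Fin #V → ℚ
    fug-nonNeg : ∀ v → 0ℚ ≤ fug v
    t₁ t₂ t₃   : Fin #V
    edges      : List (Edge #V)
    weights-nonNeg : All (λ e → 0ℚ ≤ weight e) edges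

  open Matchings fug public

  load : Bool → Bool → Bool → Fin #V → ℕ
  load x₁ x₂ x₃ v = bit x₁ (ind t₁ v) ℕ.+ (bit x₂ (ind t₂ v) ℕ.+ bit x₃ (ind t₃ v))

  sig : Bool → Bool → Bool → ℚ
  sig x₁ x₂ x₃ = count (load x₁ x₂ x₃) edges

Inequality : (Bool → Bool → Bool → ℚ) → Set
Inequality f = ∀ x₁ x₂ x₃ →
  f x₁ x₂ x₃ * f (not x₁) (not x₂) (not x₃)
    ≤ f x₁ x₂ (not x₃) * f (not x₁) (not x₂) x₃
    + f x₁ (not x₂) x₃ * f (not x₁) x₂ (not x₃)
    + f x₁ (not x₂) (not x₃) * f (not x₁) x₂ x₃

inequality-cong : ∀ {f g} → (∀ x y z → f x y z ≡ g x y z) → Inequality g → Inequality f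
inequality-cong f≡g ineq x y z = subst₂ _≤_
  (sym (cong₂ _*_ (f≡g _ _ _) (f≡g _ _ _)))
  (sym (cong₂ _+_ (cong₂ _+_ (cong₂ _*_ (f≡g _ _ _) (f≡g _ _ _)) (cong₂ _*_ (f≡g _ _ _) (f≡g _ _ _)))
    (cong₂ _*_ (f≡g _ _ _) (f≡g _ _ _))))
  (ineq x y z)

Realizable : (Bool → Bool → Bool → ℚ) → Set
Realizable f = Σ[ Γ ∈ Graph ] (∀ x₁ x₂ x₃ → f x₁ x₂ x₃ ≡ Graph.sig Γ x₁ x₂ x₃)

module SignatureInequality (Γ : Graph) where
  open Graph Γ

  bit-mix : ∀ (s : Fin #V → Bool) t v x y →
            bit (if s v then y else x) (ind t v) ≡ bit (if s t then y else x) (ind t v)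
  bit-mix s t v x y with t Fin.≟ v
  ... | yes refl = refl
  ... | no  _    = trans (bit-0 (if s v then y else x)) (sym (bit-0 (if s t then y else x)))

  -- An external edge is felt only at its own terminal, so the exchange again produces loads, with
  -- precisely the inputs at terminals in `s` exchanged.
  load-mix : ∀ s x₁ x₂ x₃ y₁ y₂ y₃ → mix s (load x₁ x₂ x₃) (load y₁ y₂ y₃) ≗
    load (if s t₁ then y₁ else x₁) (if s t₂ then y₂ else x₂) (if s t₃ then y₃ else x₃)
  load-mix s x₁ x₂ x₃ y₁ y₂ y₃ v =
    trans (float (s v)) (cong₂ ℕ._+_ (bit-mix s t₁ v x₁ y₁)
      (cong₂ ℕ._+_ (bit-mix s t₂ v x₂ y₂) (bit-mix s t₃ v x₃ y₃)))
    where
    float : ∀ b → (if b then load y₁ y₂ y₃ v else load x₁ x₂ x₃ v) ≡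
      bit (if b then y₁ else x₁) (ind t₁ v) ℕ.+
        (bit (if b then y₂ else x₂) (ind t₂ v) ℕ.+ bit (if b then y₃ else x₃) (ind t₃ v))
    float true  = refl
    float false = refl

  module _ (x₁ x₂ x₃ : Bool) where

    -- The two loads stand in the order in which the exchange delivers them, so that the cases of
    -- `bound` match definitionally. For `R₂` this reverses the order in the inequality, which a
    -- `*-comm` in `rhs` repairs.
    R₁ R₂ R₃ : Vec Bool (length edges) → ℚ
    R₁ d = pairCount edges d (load x₁ x₂ (not x₃)) (load (not x₁) (not x₂) x₃)
    R₂ d = pairCount edges d (load (not x₁) x₂ (not x₃)) (load x₁ (not x₂) x₃)
    R₃ d = pairCount edges d (load x₁ (not x₂) (not x₃)) (load (not x₁) x₂ x₃)

    0≤pairs : ∀ d u u′ → 0ℚ ≤ pairCount edges d u u′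
    0≤pairs = 0≤pairCount fug-nonNeg weights-nonNeg

    load-complement : ∀ v → load x₁ x₂ x₃ v ℕ.+ load (not x₁) (not x₂) (not x₃) v ≡
                            multiplicity id v (t₁ ∷ t₂ ∷ t₃ ∷ [])
    load-complement v = begin
      bit x₁ a ℕ.+ (bit x₂ b ℕ.+ bit x₃ c) ℕ.+ (bit (not x₁) a ℕ.+ (bit (not x₂) b ℕ.+ bit (not x₃) c))
        ≡⟨ solveℕ 6 (λ p q r p′ q′ r′ → p ⊹ (q ⊹ r) ⊹ (p′ ⊹ (q′ ⊹ r′)) ≐
             p ⊹ p′ ⊹ (q ⊹ q′ ⊹ (r ⊹ r′ ⊹ conℕ 0))) refl
             (bit x₁ a) (bit x₂ b) (bit x₃ c) (bit (not x₁) a) (bit (not x₂) b) (bit (not x₃) c) ⟩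
      bit x₁ a ℕ.+ bit (not x₁) a ℕ.+ (bit x₂ b ℕ.+ bit (not x₂) b ℕ.+ (bit x₃ c ℕ.+ bit (not x₃) c ℕ.+ 0))
        ≡⟨ cong₂ ℕ._+_ (bit-not x₁ a) (cong₂ ℕ._+_ (bit-not x₂ b) (cong (ℕ._+ 0) (bit-not x₃ c))) ⟩
      a ℕ.+ (b ℕ.+ (c ℕ.+ 0)) ∎
      where
      open ≡-Reasoning
      open ℕ.+-*-Solver using () renaming (solve to solveℕ; _:+_ to _⊹_; _:=_ to _≐_; con to conℕ)
      a = ind t₁ v
      b = ind t₂ v
      c = ind t₃ v
      bit-not : ∀ x m → bit x m ℕ.+ bit (not x) m ≡ m
      bit-not true  m = ℕ.+-identityʳ m
      bit-not false m = refl

    pairCount-bound : ∀ d → pairCount edges d (load x₁ x₂ x₃) (load (not x₁) (not x₂) (not x₃)) ≤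
                            R₁ d + R₂ d + R₃ d
    pairCount-bound d with Fin.any? (λ v → 3 ℕ.≤? multiplicity id v (ends edges d (t₁ ∷ t₂ ∷ t₃ ∷ [])))
    -- A vertex met three times makes the left side vanish; otherwise `components` can start from
    -- the discrete labelling `id`.
    ... | yes (v , 3≤) = subst (_≤ R₁ d + R₂ d + R₃ d)
      (sym (pairCount-zero edges d _ _ v (subst (3 ℕ.≤_)
        (trans (multiplicity-ends id v edges d _)
          (cong (multiplicity id v (ends edges d []) ℕ.+_) (sym (load-complement v)))) 3≤)))
      (0≤+ (0≤+ (0≤pairs d _ _) (0≤pairs d _ _)) (0≤pairs d _ _))
    ... | no ¬3≤ with components edges d (t₁ ∷ t₂ ∷ t₃ ∷ []) id
                        (λ v → ℕ.≤-pred (ℕ.≰⇒> (λ 3≤ → ¬3≤ (v , 3≤))))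
    -- Since `ind` tests the same decision as `s`, the bound at the label of t₃ is definitionally
    -- the hypothesis of `bound`. It counts t₃ itself, which leaves room for one further terminal.
    ... | c , c-es , _ , ≤2 = subst (_≤ R₁ d + R₂ d + R₃ d) (sym swapped) (bound
        (s t₁) (s t₂) (s t₃) (dec-true (c t₃ Fin.≟ c t₃) refl) (≤2 (c t₃)))
      where
      s : Fin #V → Bool
      s v = does (c v Fin.≟ c t₃)

      swapped : pairCount edges d (load x₁ x₂ x₃) (load (not x₁) (not x₂) (not x₃)) ≡
        pairCount edges d
          (load (if s t₁ then not x₁ else x₁) (if s t₂ then not x₂ else x₂) (if s t₃ then not x₃ else x₃))
          (load (if s t₁ then x₁ else not x₁) (if s t₂ then x₂ else not x₂) (if s t₃ then x₃ else not x₃))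
      swapped = trans
        (pairCount-mix s edges d _ _ (Respects-∘ (λ ℓ → does (ℓ Fin.≟ c t₃)) edges d c-es))
        (pairCount-cong edges d (load-mix s _ _ _ _ _ _) (load-mix s _ _ _ _ _ _))

      bound : ∀ s₁ s₂ s₃ → s₃ ≡ true →
        bit s₁ 1 ℕ.+ (bit s₂ 1 ℕ.+ (bit s₃ 1 ℕ.+ 0)) ℕ.≤ 2 →
        pairCount edges d
          (load (if s₁ then not x₁ else x₁) (if s₂ then not x₂ else x₂) (if s₃ then not x₃ else x₃))
          (load (if s₁ then x₁ else not x₁) (if s₂ then x₂ else not x₂) (if s₃ then x₃ else not x₃))
        ≤ R₁ d + R₂ d + R₃ d
      bound true  true  true _ (s≤s (s≤s ()))
      bound false false true _ _ = 0≤-⇒≤ (subst (0ℚ ≤_)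
        (solve 3 (λ p q r → q :+ r := p :+ q :+ r :- p) refl (R₁ d) (R₂ d) (R₃ d))
        (0≤+ (0≤pairs d _ _) (0≤pairs d _ _)))
      bound true  false true _ _ = 0≤-⇒≤ (subst (0ℚ ≤_)
        (solve 3 (λ p q r → p :+ r := p :+ q :+ r :- q) refl (R₁ d) (R₂ d) (R₃ d))
        (0≤+ (0≤pairs d _ _) (0≤pairs d _ _)))
      bound false true  true _ _ = 0≤-⇒≤ (subst (0ℚ ≤_)
        (solve 3 (λ p q r → p :+ q := p :+ q :+ r :- r) refl (R₁ d) (R₂ d) (R₃ d))
        (0≤+ (0≤pairs d _ _) (0≤pairs d _ _)))

    complement-bound :
      sig x₁ x₂ x₃ * sig (not x₁) (not x₂) (not x₃)
        ≤ sig x₁ x₂ (not x₃) * sig (not x₁) (not x₂) x₃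
        + sig x₁ (not x₂) x₃ * sig (not x₁) x₂ (not x₃)
        + sig x₁ (not x₂) (not x₃) * sig (not x₁) x₂ x₃
    complement-bound = subst₂ _≤_ (sym (count-* edges _ _)) rhs
      (Σℚ-mono ds pairCount-bound)
      where
      ds = subsets (length edges)
      rhs : Σℚ ds (λ d → R₁ d + R₂ d + R₃ d) ≡
        sig x₁ x₂ (not x₃) * sig (not x₁) (not x₂) x₃
          + sig x₁ (not x₂) x₃ * sig (not x₁) x₂ (not x₃)
          + sig x₁ (not x₂) (not x₃) * sig (not x₁) x₂ x₃
      rhs = trans (Σℚ-+ ds (λ d → R₁ d + R₂ d) R₃) (cong₂ _+_
        (trans (Σℚ-+ ds R₁ R₂) (cong₂ _+_ (sym (count-* edges _ _))
          (trans (sym (count-* edges _ _)) (*-comm (sig (not x₁) x₂ (not x₃)) _))))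
        (sym (count-* edges _ _)))

  sig-inequality : Inequality sig
  sig-inequality = complement-bound

-- A graph for every function satisfying the inequality

module Prune {k : ℕ} (fug : Fin k → ℚ) where
  open Matchings fug

  count-≥2 : ∀ es u v → 2 ℕ.≤ u v → count u es ≡ 0ℚ
  count-≥2 []       u v 2≤ = configWeight-≥2 u v 2≤
  count-≥2 (e ∷ es) u v 2≤ = trans
    (cong₂ _+_ (q≡0⇒p*q≡0 (weight e) (count-≥2 es _ v (ℕ.≤-trans 2≤ (ℕ.m≤n+m (u v) _))))
               (count-≥2 es u v 2≤))
    (+-identityˡ 0ℚ)

  used : ℕ → Bool
  used 0       = false
  used (suc _) = true

  -- An edge at an already covered vertex contributes nothing, so its branch is dropped. This spares
  -- the ring solver the 1024 edge subsets of the gadget.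
  prunedCount : (Fin k → ℕ) → List (Edge k) → ℚ
  prunedCount u []       = configWeight u
  prunedCount u (e ∷ es) =
    if used (u (end₁ e)) ∨ used (u (end₂ e))
    then prunedCount u es
    else weight e * prunedCount (addEdge e u) es + prunedCount u es

  prunedCount-correct : ∀ es u → count u es ≡ prunedCount u es
  prunedCount-correct []       u = refl
  prunedCount-correct (e ∷ es) u with u (end₁ e) in eq₁ | u (end₂ e) in eq₂
  ... | suc m | _     = trans (cong (λ p → weight e * p + count u es)
      (count-≥2 es (addEdge e u) (end₁ e) 2≤))
    (trans (cong (_+ count u es) (*-zeroʳ (weight e)))
      (trans (+-identityˡ _) (prunedCount-correct es u)))
    where
    2≤ : 2 ℕ.≤ addEdge e u (end₁ e)
    2≤ rewrite ind-refl (end₁ e) | eq₁ = s≤s (ℕ.≤-trans (s≤s z≤n) (ℕ.m≤n+m (suc m) (ind (end₂ e) (end₁ e))))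
  ... | zero | suc m = trans (cong (λ p → weight e * p + count u es)
      (count-≥2 es (addEdge e u) (end₂ e) 2≤))
    (trans (cong (_+ count u es) (*-zeroʳ (weight e)))
      (trans (+-identityˡ _) (prunedCount-correct es u)))
    where
    2≤ : 2 ℕ.≤ addEdge e u (end₂ e)
    2≤ rewrite ind-refl (end₂ e) | eq₂ = ℕ.+-mono-≤ (ℕ.m≤n+m 1 (ind (end₁ e) (end₂ e))) (s≤s z≤n)
  ... | zero | zero = cong₂ _+_ (cong (weight e *_) (prunedCount-correct es (addEdge e u)))
    (prunedCount-correct es u)

  -- prunedCount with the weights replaced by indeterminates, to feed the ring solver.
  data Edgeᴾ (n : ℕ) : Set where
    edgeᴾ : Fin k → Fin k → Polynomial n → Edgeᴾ n

  prunedCountᴾ : ∀ {n} → (Fin k → ℕ) → List (Edgeᴾ n) → Polynomial n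
  prunedCountᴾ u []                 = con (configWeight u)
  prunedCountᴾ u (edgeᴾ a b w ∷ es) =
    if used (u a) ∨ used (u b)
    then prunedCountᴾ u es
    -- `addEdge` reads only the ends, so the weight 0 is a placeholder.
    else w :* prunedCountᴾ (addEdge (edge a b 0ℚ) u) es :+ prunedCountᴾ u es

-- Vertices 0, 1, 2 are the terminals. Only vertex 3 may stay uncovered, and it is covered exactly
-- for inputs with an odd number of ones.
gadgetFug : Fin 5 → ℚ
gadgetFug 3F = 1ℚ
gadgetFug _  = 0ℚ

module Gadget (m₁ m₂ m₃ κ w₁₂ w₁₃ w₂₃ a₁ a₂ a₃ : ℚ) where

  gadgetEdges : List (Edge 5)
  gadgetEdges =
    edge 0F 4F m₁ ∷ edge 1F 4F m₂ ∷ edge 2F 4F m₃ ∷ edge 3F 4F κ ∷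
    edge 0F 1F w₁₂ ∷ edge 0F 2F w₁₃ ∷ edge 1F 2F w₂₃ ∷
    edge 0F 3F a₁ ∷ edge 1F 3F a₂ ∷ edge 2F 3F a₃ ∷ []

  gadget : All (λ e → 0ℚ ≤ weight e) gadgetEdges → Graph
  gadget 0≤weights = record
    { fug            = gadgetFug
    ; fug-nonNeg     = λ { 0F → ≤-refl ; 1F → ≤-refl ; 2F → ≤-refl ; 3F → nonNegative⁻¹ 1ℚ ; 4F → ≤-refl }
    ; t₁ = 0F ; t₂ = 1F ; t₃ = 2F
    ; edges          = gadgetEdges
    ; weights-nonNeg = 0≤weights
    }

  -- Input 111 leaves only vertices 3 and 4, which forces their edge κ; with terminal i free, that
  -- terminal must be matched to vertex 4, which gives mᵢ. The other values list the perfect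
  -- matchings of the four vertices left to cover.
  gadgetValue : Bool → Bool → Bool → ℚ
  gadgetValue true  true  true  = κ
  gadgetValue false true  true  = m₁
  gadgetValue true  false true  = m₂
  gadgetValue true  true  false = m₃
  gadgetValue true  false false = w₂₃ * κ + (a₂ * m₃ + a₃ * m₂)
  gadgetValue false true  false = w₁₃ * κ + (a₁ * m₃ + a₃ * m₁)
  gadgetValue false false true  = w₁₂ * κ + (a₁ * m₂ + a₂ * m₁)
  gadgetValue false false false = w₂₃ * m₁ + w₁₃ * m₂ + w₁₂ * m₃

  open Matchings gadgetFug
  open Prune gadgetFug

  gadgetLoad : Bool → Bool → Bool → Fin 5 → ℕ
  gadgetLoad x₁ x₂ x₃ v = bit x₁ (ind 0F v) ℕ.+ (bit x₂ (ind 1F v) ℕ.+ bit x₃ (ind 2F v))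

  gadget-count : ∀ x₁ x₂ x₃ → gadgetValue x₁ x₂ x₃ ≡ count (gadgetLoad x₁ x₂ x₃) gadgetEdges
  gadget-count x₁ x₂ x₃ = trans (pruned x₁ x₂ x₃) (sym (prunedCount-correct gadgetEdges (gadgetLoad x₁ x₂ x₃)))
    where
    G : ∀ {n} (m₁ m₂ m₃ κ w₁₂ w₁₃ w₂₃ a₁ a₂ a₃ : Polynomial n) → Bool → Bool → Bool → Polynomial n
    G m₁ m₂ m₃ κ w₁₂ w₁₃ w₂₃ a₁ a₂ a₃ x₁ x₂ x₃ = prunedCountᴾ (gadgetLoad x₁ x₂ x₃)
      (edgeᴾ 0F 4F m₁ ∷ edgeᴾ 1F 4F m₂ ∷ edgeᴾ 2F 4F m₃ ∷ edgeᴾ 3F 4F κ ∷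
       edgeᴾ 0F 1F w₁₂ ∷ edgeᴾ 0F 2F w₁₃ ∷ edgeᴾ 1F 2F w₂₃ ∷
       edgeᴾ 0F 3F a₁ ∷ edgeᴾ 1F 3F a₂ ∷ edgeᴾ 2F 3F a₃ ∷ [])

    pruned : ∀ x₁ x₂ x₃ → gadgetValue x₁ x₂ x₃ ≡ prunedCount (gadgetLoad x₁ x₂ x₃) gadgetEdges
    pruned true  true  true  = solve 10 (λ m₁ m₂ m₃ κ w₁₂ w₁₃ w₂₃ a₁ a₂ a₃ →
      κ := G m₁ m₂ m₃ κ w₁₂ w₁₃ w₂₃ a₁ a₂ a₃ true true true)
      refl m₁ m₂ m₃ κ w₁₂ w₁₃ w₂₃ a₁ a₂ a₃
    pruned false true  true  = solve 10 (λ m₁ m₂ m₃ κ w₁₂ w₁₃ w₂₃ a₁ a₂ a₃ →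
      m₁ := G m₁ m₂ m₃ κ w₁₂ w₁₃ w₂₃ a₁ a₂ a₃ false true true)
      refl m₁ m₂ m₃ κ w₁₂ w₁₃ w₂₃ a₁ a₂ a₃
    pruned true  false true  = solve 10 (λ m₁ m₂ m₃ κ w₁₂ w₁₃ w₂₃ a₁ a₂ a₃ →
      m₂ := G m₁ m₂ m₃ κ w₁₂ w₁₃ w₂₃ a₁ a₂ a₃ true false true)
      refl m₁ m₂ m₃ κ w₁₂ w₁₃ w₂₃ a₁ a₂ a₃
    pruned true  true  false = solve 10 (λ m₁ m₂ m₃ κ w₁₂ w₁₃ w₂₃ a₁ a₂ a₃ →
      m₃ := G m₁ m₂ m₃ κ w₁₂ w₁₃ w₂₃ a₁ a₂ a₃ true true false)
      refl m₁ m₂ m₃ κ w₁₂ w₁₃ w₂₃ a₁ a₂ a₃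
    pruned true  false false = solve 10 (λ m₁ m₂ m₃ κ w₁₂ w₁₃ w₂₃ a₁ a₂ a₃ →
      w₂₃ :* κ :+ (a₂ :* m₃ :+ a₃ :* m₂) := G m₁ m₂ m₃ κ w₁₂ w₁₃ w₂₃ a₁ a₂ a₃ true false false)
      refl m₁ m₂ m₃ κ w₁₂ w₁₃ w₂₃ a₁ a₂ a₃
    pruned false true  false = solve 10 (λ m₁ m₂ m₃ κ w₁₂ w₁₃ w₂₃ a₁ a₂ a₃ →
      w₁₃ :* κ :+ (a₁ :* m₃ :+ a₃ :* m₁) := G m₁ m₂ m₃ κ w₁₂ w₁₃ w₂₃ a₁ a₂ a₃ false true false)
      refl m₁ m₂ m₃ κ w₁₂ w₁₃ w₂₃ a₁ a₂ a₃
    pruned false false true  = solve 10 (λ m₁ m₂ m₃ κ w₁₂ w₁₃ w₂₃ a₁ a₂ a₃ →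
      w₁₂ :* κ :+ (a₁ :* m₂ :+ a₂ :* m₁) := G m₁ m₂ m₃ κ w₁₂ w₁₃ w₂₃ a₁ a₂ a₃ false false true)
      refl m₁ m₂ m₃ κ w₁₂ w₁₃ w₂₃ a₁ a₂ a₃
    pruned false false false = solve 10 (λ m₁ m₂ m₃ κ w₁₂ w₁₃ w₂₃ a₁ a₂ a₃ →
      w₂₃ :* m₁ :+ w₁₃ :* m₂ :+ w₁₂ :* m₃ := G m₁ m₂ m₃ κ w₁₂ w₁₃ w₂₃ a₁ a₂ a₃ false false false)
      refl m₁ m₂ m₃ κ w₁₂ w₁₃ w₂₃ a₁ a₂ a₃

complementWeights : ∀ f → (∀ x₁ x₂ x₃ → 0ℚ ≤ f x₁ x₂ x₃) → Inequality f →
  EdgeWeights (f false false false * f true true true) (f true false false * f false true true)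
              (f false true false * f true false true) (f false false true * f true true false)
complementWeights f 0≤f ineq = edgeWeights
  (0≤* (0≤f _ _ _) (0≤f _ _ _)) (0≤* (0≤f _ _ _) (0≤f _ _ _))
  (0≤* (0≤f _ _ _) (0≤f _ _ _)) (0≤* (0≤f _ _ _) (0≤f _ _ _))
  (≤-trans (ineq false false false) (≤-reflexive
    (solve 6 (λ a b c d e g → a :* b :+ c :* d :+ e :* g := g :* e :+ c :* d :+ a :* b) refl
      (f false false true) (f true true false) (f false true false) (f true false true)
      (f false true true) (f true false false))))
  (≤-trans (ineq true false false) (≤-reflexive
    (solve 6 (λ a b c d e g → a :* b :+ c :* d :+ e :* g := g :* e :+ d :* c :+ b :* a) refl
      (f true false true) (f false true false) (f true true false) (f false false true)
      (f true true true) (f false false false))))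
  (≤-trans (ineq false true false) (≤-reflexive
    (solve 6 (λ a b c d e g → a :* b :+ c :* d :+ e :* g := e :* g :+ c :* d :+ b :* a) refl
      (f false true true) (f true false false) (f false false false) (f true true true)
      (f false false true) (f true true false))))
  (≤-trans (ineq false false true) (≤-reflexive
    (solve 6 (λ a b c d e g → a :* b :+ c :* d :+ e :* g := e :* g :+ d :* c :+ a :* b) refl
      (f false false false) (f true true true) (f false true true) (f true false false)
      (f false true false) (f true false true))))

middle-zero : ∀ {a b c} → 0ℚ ≤ a → 0ℚ ≤ b → 0ℚ ≤ c → a + b + c ≡ 0ℚ → b ≡ 0ℚ
middle-zero {a} {b} {c} 0≤a 0≤b 0≤c sum≡0 = ≤-zero 0≤b (0≤-⇒≤ (subst (0ℚ ≤_)
  (trans (solve 3 (λ a b c → a :+ c := a :+ b :+ c :- b) refl a b c) (cong (_- b) sum≡0))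
  (0≤+ 0≤a 0≤c)))

last-zero : ∀ {a b c} → 0ℚ ≤ a → 0ℚ ≤ b → 0ℚ ≤ c → a + b + c ≡ 0ℚ → c ≡ 0ℚ
last-zero {a} {b} {c} 0≤a 0≤b 0≤c sum≡0 = middle-zero 0≤a 0≤c 0≤b
  (trans (solve 3 (λ a b c → a :+ c :+ b := a :+ b :+ c) refl a b c) sum≡0)

-- The remainder is what wⱼₖ κ has to be. For m nonzero it is u divided by m; for m = 0 both
-- coefficients are 0 by the convention on quotients, and the remainder is n itself.
residual : ∀ {n m b c m′ m″ u v w} → 0ℚ ≤ n → 0ℚ ≤ m → 0ℚ ≤ u → n * m ≡ u + v + w →
           b * (m * m″) ≡ w → c * (m * m′) ≡ v → (m ≡ 0ℚ → b ≡ 0ℚ) → (m ≡ 0ℚ → c ≡ 0ℚ) →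
           0ℚ ≤ n - (b * m″ + c * m′) × (n - (b * m″ + c * m′)) * m ≡ u
residual {n} {m} {b} {c} {m′} {m″} {u} 0≤n 0≤m 0≤u nm≡ refl refl b-zero c-zero =
  nonNeg (m ≟ 0ℚ) , product
  where
  product : (n - (b * m″ + c * m′)) * m ≡ u
  product = begin
    (n - (b * m″ + c * m′)) * m
      ≡⟨ solve 6 (λ n m b c m′ m″ → (n :- (b :* m″ :+ c :* m′)) :* m :=
           n :* m :- (b :* (m :* m″) :+ c :* (m :* m′))) refl n m b c m′ m″ ⟩
    n * m - (b * (m * m″) + c * (m * m′))
      ≡⟨ cong (_- (b * (m * m″) + c * (m * m′))) nm≡ ⟩
    u + c * (m * m′) + b * (m * m″) - (b * (m * m″) + c * (m * m′))
      ≡⟨ solve 3 (λ u v w → u :+ v :+ w :- (w :+ v) := u) refl u (c * (m * m′)) (b * (m * m″)) ⟩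
    u ∎
    where open ≡-Reasoning

  nonNeg : Dec (m ≡ 0ℚ) → 0ℚ ≤ n - (b * m″ + c * m′)
  nonNeg (no  m≢0) = 0≤p*r⇒0≤p m 0≤m m≢0 (subst (0ℚ ≤_) (sym product) 0≤u)
  nonNeg (yes m≡0) rewrite b-zero m≡0 | c-zero m≡0 = subst (0ℚ ≤_)
    (solve 3 (λ n m′ m″ → n := n :- (con 0ℚ :* m″ :+ con 0ℚ :* m′)) refl n m′ m″) 0≤n

module _ (f : Bool → Bool → Bool → ℚ) (0≤f : ∀ x₁ x₂ x₃ → 0ℚ ≤ f x₁ x₂ x₃)
         (ineq : Inequality f) (f₁₁₁≢0 : f true true true ≢ 0ℚ) where

  open EdgeWeights (complementWeights f 0≤f ineq)

  private
    κ m₁ m₂ m₃ n₁ n₂ n₃ : ℚ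
    κ  = f true true true
    m₁ = f false true true
    m₂ = f true false true
    m₃ = f true true false
    n₁ = f true false false
    n₂ = f false true false
    n₃ = f false false true

    -- If m₂ or m₃ is 0, then so is p₂ or p₃, and with it every edge weight at that vertex of K₄,
    -- u₂₃ included. The same argument serves `A₂` and `A₃`.
    A₁ : Quotient u₂₃ (m₂ * m₃)
    A₁ = divide _ _ 0≤u₂₃ (0≤* (0≤f _ _ _) (0≤f _ _ _)) λ m₂m₃≡0 → case p*q≡0⇒p≡0⊎q≡0 m₂ m₃ m₂m₃≡0 of λ where
      (inj₁ m₂≡0) → last-zero 0≤u₀₂ 0≤u₁₂ 0≤u₂₃ (trans (sym sum₂) (q≡0⇒p*q≡0 n₂ m₂≡0))
      (inj₂ m₃≡0) → last-zero 0≤u₀₃ 0≤u₁₃ 0≤u₂₃ (trans (sym sum₃) (q≡0⇒p*q≡0 n₃ m₃≡0))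

    A₂ : Quotient u₁₃ (m₁ * m₃)
    A₂ = divide _ _ 0≤u₁₃ (0≤* (0≤f _ _ _) (0≤f _ _ _)) λ m₁m₃≡0 → case p*q≡0⇒p≡0⊎q≡0 m₁ m₃ m₁m₃≡0 of λ where
      (inj₁ m₁≡0) → last-zero 0≤u₀₁ 0≤u₁₂ 0≤u₁₃ (trans (sym sum₁) (q≡0⇒p*q≡0 n₁ m₁≡0))
      (inj₂ m₃≡0) → middle-zero 0≤u₀₃ 0≤u₁₃ 0≤u₂₃ (trans (sym sum₃) (q≡0⇒p*q≡0 n₃ m₃≡0))

    A₃ : Quotient u₁₂ (m₁ * m₂)
    A₃ = divide _ _ 0≤u₁₂ (0≤* (0≤f _ _ _) (0≤f _ _ _)) λ m₁m₂≡0 → case p*q≡0⇒p≡0⊎q≡0 m₁ m₂ m₁m₂≡0 of λ where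
      (inj₁ m₁≡0) → middle-zero 0≤u₀₁ 0≤u₁₂ 0≤u₁₃ (trans (sym sum₁) (q≡0⇒p*q≡0 n₁ m₁≡0))
      (inj₂ m₂≡0) → middle-zero 0≤u₀₂ 0≤u₁₂ 0≤u₂₃ (trans (sym sum₂) (q≡0⇒p*q≡0 n₂ m₂≡0))

    open Quotient A₁ using () renaming (value to a₁; value-spec to a₁-spec; value-zero to a₁-zero; value-nonNeg to 0≤a₁)
    open Quotient A₂ using () renaming (value to a₂; value-spec to a₂-spec; value-zero to a₂-zero; value-nonNeg to 0≤a₂)
    open Quotient A₃ using () renaming (value to a₃; value-spec to a₃-spec; value-zero to a₃-zero; value-nonNeg to 0≤a₃)

    r₁ r₂ r₃ : ℚ
    r₁ = n₁ - (a₂ * m₃ + a₃ * m₂)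
    r₂ = n₂ - (a₁ * m₃ + a₃ * m₁)
    r₃ = n₃ - (a₁ * m₂ + a₂ * m₁)

    r₁-spec : 0ℚ ≤ r₁ × r₁ * m₁ ≡ u₀₁
    r₁-spec = residual (0≤f _ _ _) (0≤f _ _ _) 0≤u₀₁ sum₁ a₂-spec a₃-spec
      (λ m₁≡0 → a₂-zero (p≡0⇒p*q≡0 m₃ m₁≡0)) (λ m₁≡0 → a₃-zero (p≡0⇒p*q≡0 m₂ m₁≡0))

    r₂-spec : 0ℚ ≤ r₂ × r₂ * m₂ ≡ u₀₂
    r₂-spec = residual (0≤f _ _ _) (0≤f _ _ _) 0≤u₀₂ sum₂
      a₁-spec (trans (cong (a₃ *_) (*-comm m₂ m₁)) a₃-spec)
      (λ m₂≡0 → a₁-zero (p≡0⇒p*q≡0 m₃ m₂≡0)) (λ m₂≡0 → a₃-zero (q≡0⇒p*q≡0 m₁ m₂≡0))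

    r₃-spec : 0ℚ ≤ r₃ × r₃ * m₃ ≡ u₀₃
    r₃-spec = residual (0≤f _ _ _) (0≤f _ _ _) 0≤u₀₃ sum₃
      (trans (cong (a₁ *_) (*-comm m₃ m₂)) a₁-spec) (trans (cong (a₂ *_) (*-comm m₃ m₁)) a₂-spec)
      (λ m₃≡0 → a₁-zero (q≡0⇒p*q≡0 m₂ m₃≡0)) (λ m₃≡0 → a₂-zero (q≡0⇒p*q≡0 m₁ m₃≡0))

    overκ : ∀ {r} → 0ℚ ≤ r → Quotient r κ
    overκ 0≤r = divide _ κ 0≤r (0≤f _ _ _) (λ κ≡0 → contradiction κ≡0 f₁₁₁≢0)

    open Quotient (overκ (proj₁ r₁-spec)) using () renaming (value to w₂₃; value-spec to w₂₃-spec; value-nonNeg to 0≤w₂₃)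
    open Quotient (overκ (proj₁ r₂-spec)) using () renaming (value to w₁₃; value-spec to w₁₃-spec; value-nonNeg to 0≤w₁₃)
    open Quotient (overκ (proj₁ r₃-spec)) using () renaming (value to w₁₂; value-spec to w₁₂-spec; value-nonNeg to 0≤w₁₂)

    open Gadget m₁ m₂ m₃ κ w₁₂ w₁₃ w₂₃ a₁ a₂ a₃

    recover : ∀ {n s p} → p ≡ n - s → n ≡ p + s
    recover {n} {s} refl = solve 2 (λ n s → n := n :- s :+ s) refl n s

    -- No parameter is left for the value at 000. The sum at vertex 0 determines its product with κ,
    -- and κ is nonzero.
    f₀₀₀-spec : f false false false ≡ w₂₃ * m₁ + w₁₃ * m₂ + w₁₂ * m₃
    f₀₀₀-spec = *-cancelʳ-≡ κ f₁₁₁≢0 (begin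
      f false false false * κ              ≡⟨ sum₀ ⟩
      u₀₁ + u₀₂ + u₀₃                       ≡⟨ cong₂ _+_ (cong₂ _+_ (via w₂₃ w₂₃-spec (proj₂ r₁-spec))
                                                (via w₁₃ w₁₃-spec (proj₂ r₂-spec))) (via w₁₂ w₁₂-spec (proj₂ r₃-spec)) ⟨
      w₂₃ * κ * m₁ + w₁₃ * κ * m₂ + w₁₂ * κ * m₃
        ≡⟨ solve 7 (λ w₂₃ w₁₃ w₁₂ m₁ m₂ m₃ κ →
             w₂₃ :* κ :* m₁ :+ w₁₃ :* κ :* m₂ :+ w₁₂ :* κ :* m₃ :=
             (w₂₃ :* m₁ :+ w₁₃ :* m₂ :+ w₁₂ :* m₃) :* κ) refl w₂₃ w₁₃ w₁₂ m₁ m₂ m₃ κ ⟩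
      (w₂₃ * m₁ + w₁₃ * m₂ + w₁₂ * m₃) * κ ∎)
      where
      open ≡-Reasoning
      via : ∀ w {r m u} → w * κ ≡ r → r * m ≡ u → w * κ * m ≡ u
      via w refl rm≡u = rm≡u

    values : ∀ x₁ x₂ x₃ → f x₁ x₂ x₃ ≡ gadgetValue x₁ x₂ x₃
    values true  true  true  = refl
    values false true  true  = refl
    values true  false true  = refl
    values true  true  false = refl
    values true  false false = recover w₂₃-spec
    values false true  false = recover w₁₃-spec
    values false false true  = recover w₁₂-spec
    values false false false = f₀₀₀-spec

  realize₁₁₁ : Realizable f
  realize₁₁₁ =
    gadget (0≤f _ _ _ ∷ 0≤f _ _ _ ∷ 0≤f _ _ _ ∷ 0≤f _ _ _ ∷
            0≤w₁₂ ∷ 0≤w₁₃ ∷ 0≤w₂₃ ∷ 0≤a₁ ∷ 0≤a₂ ∷ 0≤a₃ ∷ []) ,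
    λ x₁ x₂ x₃ → trans (values x₁ x₂ x₃) (gadget-count x₁ x₂ x₃)

-- Permuting and flipping external edges

rotate : Realizable f → Realizable (λ x y z → f y z x)
rotate {f} (Γ , f≡sig) =
  record { fug-nonNeg = fug-nonNeg ; t₁ = t₃ ; t₂ = t₁ ; t₃ = t₂ ; weights-nonNeg = weights-nonNeg } ,
  λ x y z → trans (f≡sig y z x) (count-cong edges λ v →
    solveℕ 3 (λ p q r → p ⊹ (q ⊹ r) ≐ r ⊹ (p ⊹ q)) refl
      (bit y (ind t₁ v)) (bit z (ind t₂ v)) (bit x (ind t₃ v)))
  where
  open Graph Γ
  open ℕ.+-*-Solver using () renaming (solve to solveℕ; _:+_ to _⊹_; _:=_ to _≐_)

shift : ∀ {k} → Edge k → Edge (suc k)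
shift (edge a b w) = edge (suc a) (suc b) w

extend : ∀ {k} → (Fin k → ℚ) → Fin (suc k) → ℚ
extend fug zero    = 0ℚ
extend fug (suc v) = fug v

module _ {k : ℕ} (fug : Fin k → ℚ) where
  open Matchings fug using (count)
  open Matchings (extend fug) using () renaming (count to count⁺)

  -- Shifted edges avoid the new vertex, which therefore contributes a constant factor.
  count-shift : ∀ es u → count⁺ u (map shift es) ≡ vertexWeight 0ℚ (u zero) * count (u ∘ suc) es
  count-shift []       u = refl
  count-shift (e ∷ es) u = trans
    (cong₂ (λ p q → weight e * p + q) (count-shift es (addEdge (shift e) u)) (count-shift es u))
    (solve 4 (λ w g p q → w :* (g :* p) :+ g :* q := g :* (w :* p :+ q)) refl
      (weight e) (vertexWeight 0ℚ (u zero)) (count (addEdge e (u ∘ suc)) es) (count (u ∘ suc) es))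

-- The new vertex, of fugacity 0, passes the unused state of the new first external edge
-- on to the old one.
flip₁ : ∀ f → Realizable (λ x y z → f (not x) y z) → Realizable f
flip₁ f (Γ , f≡sig) = Γ⁺ , λ x y z →
  trans (cong (λ x → f x y z) (sym (not-involutive x))) (trans (f≡sig (not x) y z) (sig⁺ x y z))
  where
  open Graph Γ

  Γ⁺ : Graph
  Γ⁺ = record
    { fug            = extend fug
    ; fug-nonNeg     = λ { zero → ≤-refl ; (suc v) → fug-nonNeg v }
    ; t₁ = zero ; t₂ = suc t₂ ; t₃ = suc t₃
    ; edges          = edge zero (suc t₁) 1ℚ ∷ map shift edges
    ; weights-nonNeg = nonNegative⁻¹ 1ℚ ∷ All.map⁺ weights-nonNeg
    }

  sig⁺ : ∀ x y z → sig (not x) y z ≡ Graph.sig Γ⁺ x y z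
  sig⁺ x y z = trans (select x (Graph.load Γ⁺ x y z zero) load-zero)
    (sym (cong₂ (λ p q → 1ℚ * p + q) (count-shift fug edges _) (count-shift fug edges _)))
    where
    load-zero : bit x 1 ℕ.+ (bit y 0 ℕ.+ bit z 0) ≡ bit x 1
    load-zero = trans (cong₂ (λ p q → bit x 1 ℕ.+ (p ℕ.+ q)) (bit-0 y) (bit-0 z)) (ℕ.+-identityʳ _)

    -- The load `m` at the new vertex equals `bit x 1` only propositionally. With fugacity 0 that
    -- vertex needs degree exactly 1, so the connecting edge is used precisely when x is false.
    select : ∀ x m → m ≡ bit x 1 → sig (not x) y z ≡
      1ℚ * (vertexWeight 0ℚ (suc m) *
            count (λ v → ind t₁ v ℕ.+ (bit x 0 ℕ.+ (bit y (ind t₂ v) ℕ.+ bit z (ind t₃ v)))) edges)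
      + vertexWeight 0ℚ m * count (λ v → bit x 0 ℕ.+ (bit y (ind t₂ v) ℕ.+ bit z (ind t₃ v))) edges
    select true  _ refl = solve 2 (λ p q → p := con 1ℚ :* (con 0ℚ :* q) :+ con 1ℚ :* p) refl
      (sig false y z) (count (λ v → ind t₁ v ℕ.+ (bit y (ind t₂ v) ℕ.+ bit z (ind t₃ v))) edges)
    select false _ refl = solve 2 (λ p q → p := con 1ℚ :* (con 1ℚ :* p) :+ con 0ℚ :* q) refl
      (sig true y z) (count (λ v → bit y (ind t₂ v) ℕ.+ bit z (ind t₃ v)) edges)

flip₂ : ∀ f → Realizable (λ x y z → f x (not y) z) → Realizable f
flip₂ f R = rotate {λ x y z → f z x y} (flip₁ (λ x y z → f z x y)
  (rotate {λ x y z → f y (not z) x} (rotate {λ x y z → f x (not y) z} R)))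

flip₃ : ∀ f → Realizable (λ x y z → f x y (not z)) → Realizable f
flip₃ f R = rotate {λ x y z → f z x y} (rotate {λ x y z → f y z x} (flip₁ (λ x y z → f y z x)
  (rotate {λ x y z → f x y (not z)} R)))

-- Here no nonzero value can be moved to 111. An isolated vertex of fugacity 0 kills every
-- configuration.
realizable-zero : (∀ x y z → f x y z ≡ 0ℚ) → Realizable f
realizable-zero f≡0 = Γ , λ x y z →
  trans (f≡0 x y z) (sym (Πᶠ-zero 2 (λ v → vertexWeight 0ℚ (Graph.load Γ x y z v)) (suc zero)
    (cong (vertexWeight 0ℚ) (isolated x y z))))
  where
  Γ : Graph
  Γ = record
    { #V = 2 ; fug = λ _ → 0ℚ ; fug-nonNeg = λ _ → ≤-refl ; t₁ = zero ; t₂ = zero ; t₃ = zero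
    ; edges = [] ; weights-nonNeg = [] }
  isolated : ∀ x y z → Graph.load Γ x y z (suc zero) ≡ 0
  isolated x y z = cong₂ ℕ._+_ (bit-0 x) (cong₂ ℕ._+_ (bit-0 y) (bit-0 z))

private
  -- Single flips carry the nonzero value to 111. The inequality for a flipped function is
  -- definitionally the original one at the flipped point.
  BasePoint : Bool → Bool → Bool → Set
  BasePoint x y z = ∀ f → (∀ x y z → 0ℚ ≤ f x y z) → Inequality f → f x y z ≢ 0ℚ → Realizable f

  base₁₁ : ∀ z → BasePoint true true z
  base₁₁ true  = realize₁₁₁
  base₁₁ false f 0≤f ineq f≢0 = flip₃ f (realize₁₁₁ (λ x y z → f x y (not z))
    (λ x y z → 0≤f x y (not z)) (λ x y z → ineq x y (not z)) f≢0)

  base₁ : ∀ y z → BasePoint true y z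
  base₁ true  z = base₁₁ z
  base₁ false z f 0≤f ineq f≢0 = flip₂ f (base₁₁ z (λ x y z → f x (not y) z)
    (λ x y z → 0≤f x (not y) z) (λ x y z → ineq x (not y) z) f≢0)

realize-≢0 : ∀ x y z → BasePoint x y z
realize-≢0 true  y z = base₁ y z
realize-≢0 false y z f 0≤f ineq f≢0 = flip₁ f (base₁ y z (λ x y z → f (not x) y z)
  (λ x y z → 0≤f (not x) y z) (λ x y z → ineq (not x) y z) f≢0)

decideBool : ∀ {P Q : Bool → Set} → (∀ b → P b ⊎ Q b) → (∃[ b ] P b) ⊎ (∀ b → Q b)
decideBool P⊎Q with P⊎Q true | P⊎Q false
... | inj₁ p | _      = inj₁ (true , p)
... | inj₂ _ | inj₁ p = inj₁ (false , p)
... | inj₂ q | inj₂ r = inj₂ λ { true → q ; false → r }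

realize : ∀ f → (∀ x y z → 0ℚ ≤ f x y z) → Inequality f → Realizable f
realize f 0≤f ineq with decideBool (λ x → decideBool (λ y → decideBool (λ z →
                          swap (toSum (f x y z ≟ 0ℚ)))))
... | inj₁ (x , y , z , f≢0) = realize-≢0 x y z f 0≤f ineq f≢0
... | inj₂ f≡0               = realizable-zero f≡0

-- Circuits and graphs

Empty-∪ : ∀ {p q r : Subset n} → Empty (p ∩ r) → Empty (q ∩ r) → Empty ((p ∪ q) ∩ r)
Empty-∪ {p = p} {q} {r} p∩r=∅ q∩r=∅ (x , x∈) with x∈p∩q⁻ (p ∪ q) r x∈
... | x∈p∪q , x∈r = [ (λ x∈p → p∩r=∅ (x , x∈p∩q⁺ (x∈p , x∈r))) , (λ x∈q → q∩r=∅ (x , x∈p∩q⁺ (x∈q , x∈r))) ]′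
  (x∈p∪q⁻ p q x∈p∪q)

Empty-∩-comm : ∀ (p q : Subset n) → Empty (p ∩ q) → Empty (q ∩ p)
Empty-∩-comm p q = subst Empty (∩-comm p q)

∣∩∪∣ : ∀ (r p q : Subset n) → Empty (p ∩ q) → ∣ r ∩ (p ∪ q) ∣ ≡ ∣ r ∩ p ∣ ℕ.+ ∣ r ∩ q ∣
∣∩∪∣ []            []            []            _     = refl
∣∩∪∣ (outside ∷ r) (_ ∷ p)       (_ ∷ q)       p∩q=∅ = ∣∩∪∣ r p q (drop-∷-Empty p∩q=∅)
∣∩∪∣ (inside ∷ r)  (inside ∷ p)  (inside ∷ q)  p∩q=∅ = ⊥-elim (p∩q=∅ (zero , here))
∣∩∪∣ (inside ∷ r)  (inside ∷ p)  (outside ∷ q) p∩q=∅ = cong suc (∣∩∪∣ r p q (drop-∷-Empty p∩q=∅))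
∣∩∪∣ (inside ∷ r)  (outside ∷ p) (inside ∷ q)  p∩q=∅ =
  trans (cong suc (∣∩∪∣ r p q (drop-∷-Empty p∩q=∅))) (sym (ℕ.+-suc _ _))
∣∩∪∣ (inside ∷ r)  (outside ∷ p) (outside ∷ q) p∩q=∅ = ∣∩∪∣ r p q (drop-∷-Empty p∩q=∅)

∣∩⊥∣ : ∀ (r : Subset n) → ∣ r ∩ ⊥ ∣ ≡ 0
∣∩⊥∣ {n} r = trans (cong ∣_∣ (∩-zeroʳ r)) (∣⊥∣≡0 n)

∣∩⁅⁆∣-∈ : ∀ {r : Subset n} {x} → x ∈ r → ∣ r ∩ ⁅ x ⁆ ∣ ≡ 1
∣∩⁅⁆∣-∈ (here {xs = r})         = cong suc (∣∩⊥∣ r)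
∣∩⁅⁆∣-∈ (there {y = inside}  x∈r) = ∣∩⁅⁆∣-∈ x∈r
∣∩⁅⁆∣-∈ (there {y = outside} x∈r) = ∣∩⁅⁆∣-∈ x∈r

∣∩⁅⁆∣-∉ : ∀ (r : Subset n) x → ¬ x ∈ r → ∣ r ∩ ⁅ x ⁆ ∣ ≡ 0
∣∩⁅⁆∣-∉ (inside  ∷ r) zero    x∉r = contradiction here x∉r
∣∩⁅⁆∣-∉ (outside ∷ r) zero    x∉r = ∣∩⊥∣ r
∣∩⁅⁆∣-∉ (inside  ∷ r) (suc x) x∉r = ∣∩⁅⁆∣-∉ r x (x∉r ∘ there)
∣∩⁅⁆∣-∉ (outside ∷ r) (suc x) x∉r = ∣∩⁅⁆∣-∉ r x (x∉r ∘ there)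

Empty-⁅⁆ : ∀ {x y : Fin n} → x ≢ y → Empty (⁅ x ⁆ ∩ ⁅ y ⁆)
Empty-⁅⁆ {x = x} {y} x≢y (z , z∈) with x∈p∩q⁻ ⁅ x ⁆ ⁅ y ⁆ z∈
... | z∈x , z∈y = x≢y (trans (sym (x∈⁅y⁆⇒x≡y x z∈x)) (x∈⁅y⁆⇒x≡y y z∈y))

∣p∣≡0⇒p≡⊥ : ∀ (p : Subset n) → ∣ p ∣ ≡ 0 → p ≡ ⊥
∣p∣≡0⇒p≡⊥ []            _     = refl
∣p∣≡0⇒p≡⊥ (outside ∷ p) ∣p∣≡0 = cong (outside ∷_) (∣p∣≡0⇒p≡⊥ p ∣p∣≡0)

∣p∣≡1⇒p≡⁅x⁆ : ∀ (p : Subset n) → ∣ p ∣ ≡ 1 → ∃[ x ] p ≡ ⁅ x ⁆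
∣p∣≡1⇒p≡⁅x⁆ (inside  ∷ p) ∣p∣≡1 = zero , cong (inside ∷_) (∣p∣≡0⇒p≡⊥ p (ℕ.suc-injective ∣p∣≡1))
∣p∣≡1⇒p≡⁅x⁆ (outside ∷ p) ∣p∣≡1 with ∣p∣≡1⇒p≡⁅x⁆ p ∣p∣≡1
... | x , p≡⁅x⁆ = suc x , cong (outside ∷_) p≡⁅x⁆

∣p∣≡2⇒p≡⁅x⁆∪⁅y⁆ : ∀ (p : Subset n) → ∣ p ∣ ≡ 2 → ∃[ x ] ∃[ y ] (x ≢ y × p ≡ ⁅ x ⁆ ∪ ⁅ y ⁆)
∣p∣≡2⇒p≡⁅x⁆∪⁅y⁆ (inside  ∷ p) ∣p∣≡2 with ∣p∣≡1⇒p≡⁅x⁆ p (ℕ.suc-injective ∣p∣≡2)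
... | y , p≡⁅y⁆ = zero , suc y , (λ ()) , cong (inside ∷_) (trans p≡⁅y⁆ (sym (∪-identityˡ ⁅ y ⁆)))
∣p∣≡2⇒p≡⁅x⁆∪⁅y⁆ (outside ∷ p) ∣p∣≡2 with ∣p∣≡2⇒p≡⁅x⁆∪⁅y⁆ p ∣p∣≡2
... | x , y , x≢y , p≡ = suc x , suc y , x≢y ∘ Fin.suc-injective , cong (outside ∷_) p≡

Πℚ-filter-tabulate : ∀ {X : Set} (δ : X → ℕ) (φ : X → ℚ) n (h : Fin n → X) → (∀ i → δ (h i) ℕ.< 2) →
  Πℚ (filter (λ x → δ x ℕ.≟ 0) (tabulate h)) φ ≡ Πᶠ n (λ i → vertexWeight (φ (h i)) (δ (h i)))
Πℚ-filter-tabulate δ φ zero    h δ<2 = refl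
Πℚ-filter-tabulate δ φ (suc n) h δ<2 with δ (h zero) | δ<2 zero
... | 0 | _ = cong (φ (h zero) *_) (Πℚ-filter-tabulate δ φ n (h ∘ suc) (δ<2 ∘ suc))
... | 1 | _ = trans (Πℚ-filter-tabulate δ φ n (h ∘ suc) (δ<2 ∘ suc)) (sym (*-identityˡ _))
... | suc (suc _) | s≤s (s≤s ())

module Circuit (G : MatchingsCircuit) where
  open MatchingsCircuit G
  open Matchings fugacity

  wt≡ : ∀ X D → wt X D ≡ configWeight (deg X D) * Πℚ D w
  wt≡ X D with Fin.any? (λ v → 2 ℕ.≤? deg X D v)
  ... | yes (v , 2≤) = sym (p≡0⇒p*q≡0 (Πℚ D w) (configWeight-≥2 (deg X D) v 2≤))
  ... | no  ¬2≤      = cong (_* Πℚ D w) (Πℚ-filter-tabulate (deg X D) fugacity #V id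
    (λ v → ℕ.≰⇒> (λ 2≤ → ¬2≤ (v , 2≤))))

  Represents : Subset #J → Edge #V → Set
  Represents S e = (∀ v → ∣ J v ∩ S ∣ ≡ ind (end₁ e) v ℕ.+ ind (end₂ e) v) × w S ≡ weight e

  -- `Y` is general because it collects the external incidences and the edges chosen so far.
  -- Disjointness makes degrees additive, as `addEdge` assumes.
  sublists-count : ∀ {Es es} → Pointwise Represents Es es → AllPairs (λ S T → Empty (S ∩ T)) Es →
    ∀ Y → All (λ S → Empty (Y ∩ S)) Es → Σℚ (sublists Es) (wt Y) ≡ count (λ v → ∣ J v ∩ Y ∣) es
  sublists-count []                   []                    Y []            = begin
    wt Y [] + 0ℚ                       ≡⟨ +-identityʳ (wt Y []) ⟩
    wt Y []                            ≡⟨ wt≡ Y [] ⟩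
    configWeight (deg Y []) * 1ℚ       ≡⟨ *-identityʳ (configWeight (deg Y [])) ⟩
    configWeight (deg Y [])            ≡⟨ configWeight-cong (λ v → cong (λ S → ∣ J v ∩ S ∣) (∪-identityʳ Y)) ⟩
    configWeight (λ v → ∣ J v ∩ Y ∣)   ∎
    where open ≡-Reasoning
  sublists-count {S ∷ Es} {e ∷ es} ((S~e , wS≡) ∷ Es~es) (S∩Es ∷ disjoint) Y (Y∩S ∷ Y∩Es) = begin
    Σℚ (map (S ∷_) (sublists Es) ++ sublists Es) (wt Y)
      ≡⟨ Σℚ-++ (map (S ∷_) (sublists Es)) (sublists Es) (wt Y) ⟩
    Σℚ (map (S ∷_) (sublists Es)) (wt Y) + Σℚ (sublists Es) (wt Y)
      ≡⟨ cong₂ _+_ with-S (sublists-count Es~es disjoint Y Y∩Es) ⟩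
    weight e * count (addEdge e (λ v → ∣ J v ∩ Y ∣)) es + count (λ v → ∣ J v ∩ Y ∣) es ∎
    where
    open ≡-Reasoning
    wt-∷ : ∀ D → wt Y (S ∷ D) ≡ w S * wt (Y ∪ S) D
    wt-∷ D = begin
      wt Y (S ∷ D)
        ≡⟨ wt≡ Y (S ∷ D) ⟩
      configWeight (deg Y (S ∷ D)) * (w S * Πℚ D w)
        ≡⟨ cong (_* (w S * Πℚ D w)) (configWeight-cong (λ v →
             cong (λ T → ∣ J v ∩ T ∣) (sym (∪-assoc Y S (⋃ D))))) ⟩
      configWeight (deg (Y ∪ S) D) * (w S * Πℚ D w)
        ≡⟨ solve 3 (λ c a p → c :* (a :* p) := a :* (c :* p)) refl
             (configWeight (deg (Y ∪ S) D)) (w S) (Πℚ D w) ⟩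
      w S * (configWeight (deg (Y ∪ S) D) * Πℚ D w)
        ≡⟨ cong (w S *_) (wt≡ (Y ∪ S) D) ⟨
      w S * wt (Y ∪ S) D ∎
    deg-S : ∀ v → ∣ J v ∩ (Y ∪ S) ∣ ≡ addEdge e (λ v → ∣ J v ∩ Y ∣) v
    deg-S v = trans (∣∩∪∣ (J v) Y S Y∩S) (trans (ℕ.+-comm ∣ J v ∩ Y ∣ _) (cong (ℕ._+ ∣ J v ∩ Y ∣) (S~e v)))
    with-S : Σℚ (map (S ∷_) (sublists Es)) (wt Y) ≡
             weight e * count (addEdge e (λ v → ∣ J v ∩ Y ∣)) es
    with-S = begin
      Σℚ (map (S ∷_) (sublists Es)) (wt Y)
        ≡⟨ Σℚ-map (S ∷_) (sublists Es) (wt Y) ⟩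
      Σℚ (sublists Es) (λ D → wt Y (S ∷ D))
        ≡⟨ Σℚ-cong (sublists Es) wt-∷ ⟩
      Σℚ (sublists Es) (λ D → w S * wt (Y ∪ S) D)
        ≡⟨ Σℚ-*ˡ (sublists Es) (w S) (wt (Y ∪ S)) ⟩
      w S * Σℚ (sublists Es) (wt (Y ∪ S))
        ≡⟨ cong₂ _*_ wS≡ (trans
             (sublists-count Es~es disjoint (Y ∪ S)
               (All.zipWith (λ (Y∩T , S∩T) → Empty-∪ {p = Y} Y∩T S∩T) (Y∩Es , S∩Es)))
             (count-cong es deg-S)) ⟩
      weight e * count (addEdge e (λ v → ∣ J v ∩ Y ∣)) es ∎

  own : Fin #J → Fin #V
  own j = proj₁ (J-partition j)

  ∣J∩⁅⁆∣ : ∀ v j → ∣ J v ∩ ⁅ j ⁆ ∣ ≡ ind (own j) v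
  ∣J∩⁅⁆∣ v j with own j Fin.≟ v
  ... | yes refl  = ∣∩⁅⁆∣-∈ (proj₁ (proj₂ (J-partition j)))
  ... | no  own≢v = ∣∩⁅⁆∣-∉ (J v) j (λ j∈Jv → own≢v (proj₂ (proj₂ (J-partition j)) j∈Jv))

  -- The body of `support`, whose local function has no name here.
  supportAt : (x : External → Bool) → Σ[ g ∈ (Fin #J → Bool) ] support x ≡ Vec.tabulate g
  supportAt x = _ , refl

  supportAt-∈ : ∀ x {j} (j∈A : j ∈ A) → proj₁ (supportAt x) j ≡ x (j , j∈A)
  supportAt-∈ x {j} j∈A with j ∈? A
  ... | yes j∈A′ = cong (λ p → x (j , p)) ([]=-irrelevant j∈A′ j∈A)
  ... | no  j∉A  = contradiction j∈A j∉A

  supportAt-∉ : ∀ x {j} → ¬ j ∈ A → proj₁ (supportAt x) j ≡ false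
  supportAt-∉ x {j} j∉A with j ∈? A
  ... | yes j∈A = contradiction j∈A j∉A
  ... | no  _   = refl

  lookup-support : ∀ x {j} (j∈A : j ∈ A) → lookup (support x) j ≡ x (j , j∈A)
  lookup-support x {j} j∈A = trans (lookup∘tabulate (proj₁ (supportAt x)) j) (supportAt-∈ x j∈A)

  support⊆A : ∀ x → support x ⊆ A
  support⊆A x {j} j∈support with j ∈? A
  ... | yes j∈A = j∈A
  ... | no  j∉A = contradiction (trans (sym ([]=⇒lookup j∈support))
    (trans (lookup∘tabulate (proj₁ (supportAt x)) j) (supportAt-∉ x j∉A))) λ ()

  module _ (φ : External ⤖ Fin 3) where
    open Inverse (⤖⇒↔ φ) using (from; strictlyInverseˡ; strictlyInverseʳ)
    open Bijection φ using (to)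

    terminal : Fin 3 → Fin #J
    terminal i = proj₁ (from i)

    terminal-injective : ∀ {i j} → terminal i ≡ terminal j → i ≡ j
    terminal-injective {i} {j} eq = trans (sym (strictlyInverseˡ i))
      (trans (cong to (external-≡ (from i) (from j) eq)) (strictlyInverseˡ j))
      where
      external-≡ : ∀ (a b : External) → proj₁ a ≡ proj₁ b → a ≡ b
      external-≡ (a , a∈A) (_ , b∈A) refl = cong (a ,_) ([]=-irrelevant a∈A b∈A)

    select : Bool → Fin 3 → Subset #J
    select x i = if x then ⁅ terminal i ⁆ else ⊥

    ∈-select : ∀ {x i j} → j ∈ select x i → x ≡ true × j ≡ terminal i
    ∈-select {true}  {i} j∈ = refl , x∈⁅y⁆⇒x≡y (terminal i) j∈
    ∈-select {false}     j∈ = contradiction j∈ ∉⊥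

    ∣J∩select∣ : ∀ v x i → ∣ J v ∩ select x i ∣ ≡ bit x (ind (own (terminal i)) v)
    ∣J∩select∣ v true  i = ∣J∩⁅⁆∣ v (terminal i)
    ∣J∩select∣ v false i = ∣∩⊥∣ (J v)

    select-disjoint : ∀ x y {i j} → i ≢ j → Empty (select x i ∩ select y j)
    select-disjoint x y {i} {j} i≢j (z , z∈) with x∈p∩q⁻ (select x i) (select y j) z∈
    ... | z∈x , z∈y = i≢j (terminal-injective
      (trans (sym (proj₂ (∈-select {x} z∈x))) (proj₂ (∈-select {y} z∈y))))

    module _ (x₁ x₂ x₃ : Bool) where
      private
        x : Vec Bool 3
        x = x₁ ∷ x₂ ∷ x₃ ∷ []

        input : External → Bool
        input a = lookup x (to a)

        sets : Subset #J
        sets = select x₁ 0F ∪ (select x₂ 1F ∪ select x₃ 2F)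

      select-⊆ : ∀ i → select (lookup x i) i ⊆ sets
      select-⊆ 0F = p⊆p∪q _
      select-⊆ 1F = q⊆p∪q (select x₁ 0F) _ ∘ p⊆p∪q _
      select-⊆ 2F = q⊆p∪q (select x₁ 0F) _ ∘ q⊆p∪q (select x₂ 1F) _

      -- Rewrites the incidence-wise definition as a union of three optional singletons, so that
      -- each external edge contributes its own summand to the degree.
      support≡ : support input ≡ sets
      support≡ = ⊆-antisym support⊆sets sets⊆support
        where
        support⊆sets : support input ⊆ sets
        support⊆sets {j} j∈ = select-⊆ i (subst (λ b → j ∈ (if b then ⁅ terminal i ⁆ else ⊥)) (sym xᵢ≡true)
            (subst (λ k → j ∈ ⁅ k ⁆) (sym (cong proj₁ (strictlyInverseʳ (j , j∈A)))) (x∈⁅x⁆ j)))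
          where
          j∈A = support⊆A input j∈
          i = to (j , j∈A)
          xᵢ≡true : lookup x i ≡ true
          xᵢ≡true = trans (sym (lookup-support input j∈A)) ([]=⇒lookup j∈)

        select⊆support : ∀ i → select (lookup x i) i ⊆ support input
        select⊆support i {j} j∈ with ∈-select {lookup x i} j∈
        ... | xᵢ≡true , refl = lookup⇒[]= (terminal i) (support input)
          (trans (lookup-support input (proj₂ (from i)))
            (trans (cong (lookup x) (strictlyInverseˡ i)) xᵢ≡true))

        sets⊆support : sets ⊆ support input
        sets⊆support j∈ with x∈p∪q⁻ (select x₁ 0F) _ j∈
        ... | inj₁ j∈₁ = select⊆support 0F j∈₁
        ... | inj₂ j∈₂₃ with x∈p∪q⁻ (select x₂ 1F) _ j∈₂₃
        ...   | inj₁ j∈₂ = select⊆support 1F j∈₂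
        ...   | inj₂ j∈₃ = select⊆support 2F j∈₃

      ∣J∩support∣ : ∀ v → ∣ J v ∩ support input ∣ ≡
        bit x₁ (ind (own (terminal 0F)) v) ℕ.+
          (bit x₂ (ind (own (terminal 1F)) v) ℕ.+ bit x₃ (ind (own (terminal 2F)) v))
      ∣J∩support∣ v = begin
        ∣ J v ∩ support input ∣
          ≡⟨ cong (λ S → ∣ J v ∩ S ∣) support≡ ⟩
        ∣ J v ∩ sets ∣
          ≡⟨ ∣∩∪∣ (J v) (select x₁ 0F) _ (Empty-∩-comm _ (select x₁ 0F) (Empty-∪ {p = select x₂ 1F}
               (select-disjoint x₂ x₁ λ ()) (select-disjoint x₃ x₁ λ ()))) ⟩
        ∣ J v ∩ select x₁ 0F ∣ ℕ.+ ∣ J v ∩ (select x₂ 1F ∪ select x₃ 2F) ∣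
          ≡⟨ cong (∣ J v ∩ select x₁ 0F ∣ ℕ.+_)
               (∣∩∪∣ (J v) (select x₂ 1F) (select x₃ 2F) (select-disjoint x₂ x₃ λ ())) ⟩
        ∣ J v ∩ select x₁ 0F ∣ ℕ.+ (∣ J v ∩ select x₂ 1F ∣ ℕ.+ ∣ J v ∩ select x₃ 2F ∣)
          ≡⟨ cong₂ ℕ._+_ (∣J∩select∣ v x₁ 0F) (cong₂ ℕ._+_ (∣J∩select∣ v x₂ 1F) (∣J∩select∣ v x₃ 2F)) ⟩
        bit x₁ (ind (own (terminal 0F)) v) ℕ.+
          (bit x₂ (ind (own (terminal 1F)) v) ℕ.+ bit x₃ (ind (own (terminal 2F)) v)) ∎
        where open ≡-Reasoning

      signature-count : ∀ {es} → Pointwise Represents E es → signature input ≡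
        count (λ v → bit x₁ (ind (own (terminal 0F)) v) ℕ.+
          (bit x₂ (ind (own (terminal 1F)) v) ℕ.+ bit x₃ (ind (own (terminal 2F)) v))) es
      signature-count {es} E~es = trans
        (sublists-count E~es (proj₁ (proj₂ E-partition)) (support input) (All.tabulate support∩E))
        (count-cong es ∣J∩support∣)
        where
        ∈⇒⊆⋃ : ∀ {S Es} → S ∈ˡ Es → S ⊆ ⋃ Es
        ∈⇒⊆⋃ (here refl)                   = p⊆p∪q _
        ∈⇒⊆⋃ {Es = T ∷ _} (there S∈Es) x∈S = q⊆p∪q T _ (∈⇒⊆⋃ S∈Es x∈S)

        support∩E : ∀ {S} → S ∈ˡ E → Empty (support input ∩ S)
        support∩E {S} S∈E (j , j∈) with x∈p∩q⁻ (support input) S j∈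
        ... | j∈support , j∈S = x∈∁p⇒x∉p
          (subst (j ∈_) (proj₂ (proj₂ E-partition)) (∈⇒⊆⋃ S∈E j∈S)) (support⊆A input j∈support)

    representation : ∀ Es → All (λ S → ∣ S ∣ ≡ 2) Es → All (λ S → 0ℚ ≤ w S) Es →
      Σ[ es ∈ List (Edge #V) ] (Pointwise Represents Es es × All (λ e → 0ℚ ≤ weight e) es)
    representation []       []               []           = [] , [] , []
    representation (S ∷ Es) (∣S∣≡2 ∷ ∣Es∣≡2) (0≤wS ∷ 0≤w)
      with representation Es ∣Es∣≡2 0≤w | ∣p∣≡2⇒p≡⁅x⁆∪⁅y⁆ S ∣S∣≡2
    ... | es , Es~es , 0≤es | p , q , p≢q , refl =
      edge (own p) (own q) (w S) ∷ es ,
      ((λ v → trans (∣∩∪∣ (J v) ⁅ p ⁆ ⁅ q ⁆ (Empty-⁅⁆ p≢q)) (cong₂ ℕ._+_ (∣J∩⁅⁆∣ v p) (∣J∩⁅⁆∣ v q)))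
        , refl) ∷ Es~es ,
      0≤wS ∷ 0≤es

    realizable : Realizable (λ x₁ x₂ x₃ → signature (λ a → lookup (x₁ ∷ x₂ ∷ x₃ ∷ []) (to a)))
    realizable with representation E (proj₁ E-partition) (All.tabulate (λ {S} → w-nonNeg S))
    ... | es , E~es , 0≤es =
      record { fug = fugacity ; fug-nonNeg = fugacity-nonNeg ; weights-nonNeg = 0≤es
             ; t₁ = own (terminal 0F) ; t₂ = own (terminal 1F) ; t₃ = own (terminal 2F) } ,
      λ x₁ x₂ x₃ → signature-count x₁ x₂ x₃ E~es

-- From graphs back to circuits

module Realization (Γ : Graph) where
  open Graph Γ

  -- Incidences are numbered two per internal edge, with the three external ones last, so each
  -- further edge merely prepends a pair.
  size : List (Edge #V) → ℕ
  size []       = 3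
  size (_ ∷ es) = suc (suc (size es))

  owner : ∀ es → Vec (Fin #V) (size es)
  owner []       = t₁ ∷ t₂ ∷ t₃ ∷ []
  owner (e ∷ es) = end₁ e ∷ end₂ e ∷ owner es

  external : ∀ es → Subset (size es)
  external []       = ⊤
  external (_ ∷ es) = outside ∷ outside ∷ external es

  skip : ∀ {n} → Subset n → Subset (suc (suc n))
  skip S = outside ∷ outside ∷ S

  pairs : ∀ es → List (Subset (size es))
  pairs []       = []
  pairs (_ ∷ es) = (inside ∷ inside ∷ ⊥) ∷ map skip (pairs es)

  -- A pair is recognised by the position of its first incidence. The final 0 is a default that no
  -- pair reaches.
  pairWeight : ∀ es → Subset (size es) → ℚ
  pairWeight []       _                 = 0ℚ
  pairWeight (e ∷ es) (inside  ∷ _)     = weight e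
  pairWeight (e ∷ es) (outside ∷ _ ∷ S) = pairWeight es S

  at : ∀ es → Fin #V → Subset (size es)
  at es v = Vec.map (λ u → does (u Fin.≟ v)) (owner es)

  at-partition : ∀ es j → j ∈ at es (lookup (owner es) j) × (∀ {v} → j ∈ at es v → lookup (owner es) j ≡ v)
  at-partition es j =
    lookup⇒[]= j _ (trans (lookup-map j _ (owner es)) (dec-true (lookup (owner es) j Fin.≟ lookup (owner es) j) refl)) ,
    λ {v} j∈ → does-true (lookup (owner es) j Fin.≟ v)
      (trans (sym (lookup-map j _ (owner es))) ([]=⇒lookup j∈))
    where
    does-true : ∀ {P : Set} (P? : Dec P) → does P? ≡ true → P
    does-true (yes p) _ = p

  ⋃-skip : ∀ {n} (Es : List (Subset n)) → ⋃ (map skip Es) ≡ skip (⋃ Es)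
  ⋃-skip []       = refl
  ⋃-skip (S ∷ Es) = cong (skip S ∪_) (⋃-skip Es)

  Empty-skip : ∀ {n} {S T : Subset n} → Empty (S ∩ T) → Empty (skip S ∩ skip T)
  Empty-skip S∩T (suc (suc j) , there (there j∈)) = S∩T (j , j∈)

  Empty-first : ∀ {n} {T : Subset n} → Empty ((inside ∷ inside ∷ ⊥) ∩ skip T)
  Empty-first {T = T} (suc (suc j) , there (there j∈)) = ∉⊥ (proj₁ (x∈p∩q⁻ ⊥ T j∈))

  pairs-partition : ∀ es → IsPartition (_≡ 2) (∁ (external es)) (pairs es)
  pairs-partition []       = [] , [] , refl
  pairs-partition (e ∷ es) with pairs-partition es
  ... | sizes , disjoint , union =
    cong (2 ℕ.+_) (∣⊥∣≡0 (size es)) ∷ All.map⁺ sizes ,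
    All.map⁺ (All.universal (λ _ → Empty-first) (pairs es)) ∷
      AllPairs.map⁺ (AllPairs.map (λ {S} {T} → Empty-skip {S = S} {T}) disjoint) ,
    trans (cong ((inside ∷ inside ∷ ⊥) ∪_) (⋃-skip (pairs es)))
      (cong (λ S → inside ∷ inside ∷ S) (trans (∪-identityˡ _) union))

  pairWeight-nonNeg : ∀ {es} → All (λ e → 0ℚ ≤ weight e) es → All (λ S → 0ℚ ≤ pairWeight es S) (pairs es)
  pairWeight-nonNeg []           = []
  pairWeight-nonNeg (0≤w ∷ 0≤ws) = 0≤w ∷ All.map⁺ (pairWeight-nonNeg 0≤ws)

  circuit : MatchingsCircuit
  circuit = record
    { #J              = size edges
    ; #V              = #V
    ; J               = at edges
    ; J-partition     = λ j → lookup (owner edges) j , at-partition edges j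
    ; A               = external edges
    ; E               = pairs edges
    ; E-partition     = pairs-partition edges
    ; w               = pairWeight edges
    ; w-nonNeg        = λ _ → All.lookup (pairWeight-nonNeg weights-nonNeg)
    ; fugacity        = fug
    ; fugacity-nonNeg = fug-nonNeg
    }

  externals : ∀ es → (Σ[ j ∈ Fin (size es) ] j ∈ external es) ↔ Fin 3
  externals []       = mk↔ₛ′ proj₁ (λ j → j , ∈⊤) (λ _ → refl)
    λ { (0F , here) → refl ; (1F , there here) → refl ; (2F , there (there here)) → refl }
  externals (e ∷ es) = mk↔ₛ′
    (λ { (suc (suc j) , there (there j∈)) → to (j , j∈) })
    (λ i → suc (suc (proj₁ (from i))) , there (there (proj₂ (from i))))
    strictlyInverseˡ
    λ { (suc (suc j) , there (there j∈)) →
      cong (λ (j , j∈) → suc (suc j) , there (there j∈)) (strictlyInverseʳ (j , j∈)) }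
    where open Inverse (externals es)

  open Circuit circuit

  -- `Represents` is spelled out because the induction runs over arbitrary edge lists, while the
  -- circuit is built from the full list only.
  pairs-represent : ∀ es → Pointwise
    (λ S e → (∀ v → ∣ at es v ∩ S ∣ ≡ ind (end₁ e) v ℕ.+ ind (end₂ e) v) × pairWeight es S ≡ weight e)
    (pairs es) es
  pairs-represent []       = []
  pairs-represent (e ∷ es) = ((λ v → first v) , refl) ∷ shifted (pairs-represent es)
    where
    ∣∷∩inside∣ : ∀ {n} b (p q : Subset n) → ∣ (b ∷ p) ∩ (inside ∷ q) ∣ ≡ (if b then 1 else 0) ℕ.+ ∣ p ∩ q ∣
    ∣∷∩inside∣ true  p q = refl
    ∣∷∩inside∣ false p q = refl

    ∣∷∩outside∣ : ∀ {n} b (p q : Subset n) → ∣ (b ∷ p) ∩ (outside ∷ q) ∣ ≡ ∣ p ∩ q ∣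
    ∣∷∩outside∣ true  p q = refl
    ∣∷∩outside∣ false p q = refl

    first : ∀ v → ∣ at (e ∷ es) v ∩ (inside ∷ inside ∷ ⊥) ∣ ≡ ind (end₁ e) v ℕ.+ ind (end₂ e) v
    first v = trans (∣∷∩inside∣ (does (end₁ e Fin.≟ v)) (does (end₂ e Fin.≟ v) ∷ at es v) (inside ∷ ⊥)) (cong (ind (end₁ e) v ℕ.+_)
      (trans (∣∷∩inside∣ (does (end₂ e Fin.≟ v)) (at es v) ⊥)
        (trans (cong (ind (end₂ e) v ℕ.+_) (∣∩⊥∣ (at es v))) (ℕ.+-identityʳ _))))

    shifted : ∀ {Es fs} → Pointwise
      (λ S f → (∀ v → ∣ at es v ∩ S ∣ ≡ ind (end₁ f) v ℕ.+ ind (end₂ f) v) × pairWeight es S ≡ weight f) Es fs →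
      Pointwise (λ S f → (∀ v → ∣ at (e ∷ es) v ∩ S ∣ ≡ ind (end₁ f) v ℕ.+ ind (end₂ f) v)
        × pairWeight (e ∷ es) S ≡ weight f) (map skip Es) fs
    shifted []                             = []
    shifted {S ∷ _} ((∣S∣ , wS) ∷ Es~fs) =
      ((λ v → trans (∣∷∩outside∣ (does (end₁ e Fin.≟ v)) (does (end₂ e Fin.≟ v) ∷ at es v) (outside ∷ S))
        (trans (∣∷∩outside∣ (does (end₂ e Fin.≟ v)) (at es v) S) (∣S∣ v))) , wS) ∷ shifted Es~fs

  owner-terminal : ∀ es i → lookup (owner es) (proj₁ (Inverse.from (externals es) i)) ≡
                            lookup (t₁ ∷ t₂ ∷ t₃ ∷ []) i
  owner-terminal []       i = refl
  owner-terminal (e ∷ es) i = owner-terminal es i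

  hasMatchingsCircuit : ∀ (F : Vec Bool 3 → ℚ) → (∀ x₁ x₂ x₃ → F (x₁ ∷ x₂ ∷ x₃ ∷ []) ≡ sig x₁ x₂ x₃) →
                        HasMatchingsCircuit F
  hasMatchingsCircuit F F≡sig = circuit , φ , λ where
      (x₁ ∷ x₂ ∷ x₃ ∷ []) → trans (F≡sig x₁ x₂ x₃) (sym (trans
        (signature-count φ x₁ x₂ x₃ (pairs-represent edges))
        (count-cong edges λ v → cong₂ ℕ._+_ (cong (λ t → bit x₁ (ind t v)) (owner-terminal edges 0F))
          (cong₂ ℕ._+_ (cong (λ t → bit x₂ (ind t v)) (owner-terminal edges 1F))
                       (cong (λ t → bit x₃ (ind t v)) (owner-terminal edges 2F))))))
    where
    φ : MatchingsCircuit.External circuit ⤖ Fin 3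
    φ = ↔⇒⤖ (externals edges)

-- Windability

pattern 1ᵇ = true
pattern 0ᵇ = false

ones S₁ S₂ S₃ : Subset 3
ones = 1ᵇ ∷ 1ᵇ ∷ 1ᵇ ∷ []
S₁   = 1ᵇ ∷ 0ᵇ ∷ 0ᵇ ∷ []
S₂   = 0ᵇ ∷ 1ᵇ ∷ 0ᵇ ∷ []
S₃   = 0ᵇ ∷ 0ᵇ ∷ 1ᵇ ∷ []

-- Match′ ones evaluates to M₃ ∷ M₂ ∷ M₁ ∷ M₀ ∷ [].
M₀ M₁ M₂ M₃ : List (Subset 3)
M₀ = S₁ ∷ S₂ ∷ S₃ ∷ []
M₁ = S₁ ∷ (0ᵇ ∷ 1ᵇ ∷ 1ᵇ ∷ []) ∷ []
M₂ = (1ᵇ ∷ 0ᵇ ∷ 1ᵇ ∷ []) ∷ S₂ ∷ []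
M₃ = (1ᵇ ∷ 1ᵇ ∷ 0ᵇ ∷ []) ∷ S₃ ∷ []

xor-cancel : ∀ a b c → (a xor c) xor (b xor c) ≡ a xor b
xor-cancel 1ᵇ 1ᵇ 1ᵇ = refl
xor-cancel 1ᵇ 1ᵇ 0ᵇ = refl
xor-cancel 1ᵇ 0ᵇ 1ᵇ = refl
xor-cancel 1ᵇ 0ᵇ 0ᵇ = refl
xor-cancel 0ᵇ 1ᵇ 1ᵇ = refl
xor-cancel 0ᵇ 1ᵇ 0ᵇ = refl
xor-cancel 0ᵇ 0ᵇ 1ᵇ = refl
xor-cancel 0ᵇ 0ᵇ 0ᵇ = refl

⊕-cancel : ∀ {n} (x y s : Vec Bool n) → (x ⊕ s) ⊕ (y ⊕ s) ≡ x ⊕ y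
⊕-cancel []      []      []      = refl
⊕-cancel (a ∷ x) (b ∷ y) (c ∷ s) = cong₂ _∷_ (xor-cancel a b c) (⊕-cancel x y s)

⊕-involutiveˡ : ∀ {n} (x y : Vec Bool n) → x ⊕ (x ⊕ y) ≡ y
⊕-involutiveˡ []       []      = refl
⊕-involutiveˡ (1ᵇ ∷ x) (b ∷ y) = cong₂ _∷_ (not-involutive b) (⊕-involutiveˡ x y)
⊕-involutiveˡ (0ᵇ ∷ x) (b ∷ y) = cong (b ∷_) (⊕-involutiveˡ x y)

⊕-comm : ∀ {n} (x y : Vec Bool n) → x ⊕ y ≡ y ⊕ x
⊕-comm = zipWith-comm xor-comm

module _ {F : Vec Bool 3 → ℚ} (W : Windable F) where
  open Windable W renaming (nonNegative to B-nonNegative)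

  private
    M₀∈ : M₀ ∈ˡ Match′ ones
    M₀∈ = there (there (there (here refl)))
    M₁∈ : M₁ ∈ˡ Match′ ones
    M₁∈ = there (there (here refl))
    M₂∈ : M₂ ∈ˡ Match′ ones
    M₂∈ = there (here refl)
    M₃∈ : M₃ ∈ˡ Match′ ones
    M₃∈ = here refl

    B-nonNeg : ∀ x y → x ⊕ y ≡ ones → ∀ {M} → M ∈ˡ Match′ ones → 0ℚ ≤ B x y M
    B-nonNeg x y eq M∈ = B-nonNegative x y _ (subst (λ z → _ ∈ˡ Match′ z) (sym eq) M∈)

    B-sum : ∀ x y → x ⊕ y ≡ ones →
            F x * F y ≡ B x y M₃ + (B x y M₂ + (B x y M₁ + (B x y M₀ + 0ℚ)))
    B-sum x y eq = trans (sums x y) (cong (λ z → Σℚ (Match′ z) (B x y)) eq)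

    B-invariant : ∀ x y → x ⊕ y ≡ ones → ∀ {M} S → M ∈ˡ Match′ ones → S ∈ˡ M →
                  B (x ⊕ S) (y ⊕ S) M ≡ B x y M
    B-invariant x y eq S M∈ S∈M =
      sym (invariant x y _ S (subst (λ z → _ ∈ˡ Match′ z) (sym eq) M∈) S∈M)

    -- Each of the blocks S₁, S₂, S₃ belongs to M₀ and to exactly one other partition.
    complement-bound : ∀ x y → x ⊕ y ≡ ones →
      F x * F y ≤ F (x ⊕ S₃) * F (y ⊕ S₃) + F (x ⊕ S₂) * F (y ⊕ S₂) + F (y ⊕ S₁) * F (x ⊕ S₁)
    complement-bound x y eq = subst₂ _≤_ (sym (B-sum x y eq))
      (cong₂ _+_ (cong₂ _+_
        (trans (cong₂ (λ p q → p + (b S₃ M₂ + (b S₃ M₁ + (q + 0ℚ))))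
          (sym (B-invariant x y eq S₃ M₃∈ (there (here refl))))
          (sym (B-invariant x y eq S₃ M₀∈ (there (there (here refl)))))) (total S₃))
        (trans (cong (λ p → b S₂ M₃ + (p + (b S₂ M₁ + (b S₂ M₀ + 0ℚ))))
          (sym (B-invariant x y eq S₂ M₂∈ (there (here refl))))) (total S₂)))
        (trans (cong (λ p → b S₁ M₃ + (b S₁ M₂ + (p + (b S₁ M₀ + 0ℚ))))
          (sym (B-invariant x y eq S₁ M₁∈ (here refl))))
          -- As y is the complement of x, flipping the last two coordinates of x gives y ⊕ S₁; hence
          -- the reversed product.
          (trans (total S₁) (*-comm (F (x ⊕ S₁)) (F (y ⊕ S₁))))))
      -- Of the twelve terms on the right four make up the left side; M₀, available in all three
      -- sums, is taken from that of S₃. The other eight are nonnegative.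
      (0≤-⇒≤ (subst (0ℚ ≤_)
        (solve 12 (λ a₃ a₂ a₁ a₀ c d e g h i j k →
           c :+ d :+ e :+ g :+ h :+ i :+ j :+ k :=
           (a₃ :+ (c :+ (d :+ (a₀ :+ con 0ℚ)))) :+ (e :+ (a₂ :+ (g :+ (h :+ con 0ℚ))))
             :+ (i :+ (j :+ (a₁ :+ (k :+ con 0ℚ)))) :- (a₃ :+ (a₂ :+ (a₁ :+ (a₀ :+ con 0ℚ)))))
          refl (B x y M₃) (B x y M₂) (B x y M₁) (B x y M₀) (b S₃ M₂) (b S₃ M₁)
          (b S₂ M₃) (b S₂ M₁) (b S₂ M₀) (b S₁ M₃) (b S₁ M₂) (b S₁ M₀))
        (0≤+ (0≤+ (0≤+ (0≤+ (0≤+ (0≤+ (0≤+ (0≤b S₃ M₂∈) (0≤b S₃ M₁∈)) (0≤b S₂ M₃∈)) (0≤b S₂ M₁∈))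
          (0≤b S₂ M₀∈)) (0≤b S₁ M₃∈)) (0≤b S₁ M₂∈)) (0≤b S₁ M₀∈))))
      where
      b : Subset 3 → List (Subset 3) → ℚ
      b S M = B (x ⊕ S) (y ⊕ S) M
      eq′ : ∀ S → (x ⊕ S) ⊕ (y ⊕ S) ≡ ones
      eq′ S = trans (⊕-cancel x y S) eq
      0≤b : ∀ S {M} → M ∈ˡ Match′ ones → 0ℚ ≤ b S M
      0≤b S = B-nonNeg (x ⊕ S) (y ⊕ S) (eq′ S)
      total : ∀ S → b S M₃ + (b S M₂ + (b S M₁ + (b S M₀ + 0ℚ))) ≡ F (x ⊕ S) * F (y ⊕ S)
      total S = sym (B-sum (x ⊕ S) (y ⊕ S) (eq′ S))

  windable⇒complementInequality : ComplementInequality F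
  windable⇒complementInequality 1ᵇ 1ᵇ 1ᵇ = complement-bound (1ᵇ ∷ 1ᵇ ∷ 1ᵇ ∷ []) (0ᵇ ∷ 0ᵇ ∷ 0ᵇ ∷ []) refl
  windable⇒complementInequality 1ᵇ 1ᵇ 0ᵇ = complement-bound (1ᵇ ∷ 1ᵇ ∷ 0ᵇ ∷ []) (0ᵇ ∷ 0ᵇ ∷ 1ᵇ ∷ []) refl
  windable⇒complementInequality 1ᵇ 0ᵇ 1ᵇ = complement-bound (1ᵇ ∷ 0ᵇ ∷ 1ᵇ ∷ []) (0ᵇ ∷ 1ᵇ ∷ 0ᵇ ∷ []) refl
  windable⇒complementInequality 1ᵇ 0ᵇ 0ᵇ = complement-bound (1ᵇ ∷ 0ᵇ ∷ 0ᵇ ∷ []) (0ᵇ ∷ 1ᵇ ∷ 1ᵇ ∷ []) refl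
  windable⇒complementInequality 0ᵇ 1ᵇ 1ᵇ = complement-bound (0ᵇ ∷ 1ᵇ ∷ 1ᵇ ∷ []) (1ᵇ ∷ 0ᵇ ∷ 0ᵇ ∷ []) refl
  windable⇒complementInequality 0ᵇ 1ᵇ 0ᵇ = complement-bound (0ᵇ ∷ 1ᵇ ∷ 0ᵇ ∷ []) (1ᵇ ∷ 0ᵇ ∷ 1ᵇ ∷ []) refl
  windable⇒complementInequality 0ᵇ 0ᵇ 1ᵇ = complement-bound (0ᵇ ∷ 0ᵇ ∷ 1ᵇ ∷ []) (1ᵇ ∷ 1ᵇ ∷ 0ᵇ ∷ []) refl
  windable⇒complementInequality 0ᵇ 0ᵇ 0ᵇ = complement-bound (0ᵇ ∷ 0ᵇ ∷ 0ᵇ ∷ []) (1ᵇ ∷ 1ᵇ ∷ 1ᵇ ∷ []) refl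

-- A winding from the edge weights of K₄

module _ {F : Vec Bool 3 → ℚ} (0≤F : ∀ x → 0ℚ ≤ F x) (ineq : ComplementInequality F) where

  open EdgeWeights (complementWeights (λ x₁ x₂ x₃ → F (x₁ ∷ x₂ ∷ x₃ ∷ []))
    (λ x₁ x₂ x₃ → 0≤F (x₁ ∷ x₂ ∷ x₃ ∷ [])) ineq)

  private
    ifNonNeg : ∀ b {p q} → 0ℚ ≤ p → 0ℚ ≤ q → 0ℚ ≤ (if b then p else q)
    ifNonNeg 1ᵇ 0≤p _   = 0≤p
    ifNonNeg 0ᵇ _   0≤q = 0≤q

    -- A partition of {1,2,3} into two blocks is recognised by its second block.
    crossing : Subset 3 → Vec Bool 3 → ℚ
    crossing (0ᵇ ∷ 0ᵇ ∷ 1ᵇ ∷ []) (x₁ ∷ x₂ ∷ x₃ ∷ []) = if x₁ xor x₂ then u₁₂ else u₀₃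
    crossing (0ᵇ ∷ 1ᵇ ∷ 0ᵇ ∷ []) (x₁ ∷ x₂ ∷ x₃ ∷ []) = if x₁ xor x₃ then u₁₃ else u₀₂
    crossing (0ᵇ ∷ 1ᵇ ∷ 1ᵇ ∷ []) (x₁ ∷ x₂ ∷ x₃ ∷ []) = if x₂ xor x₃ then u₂₃ else u₀₁
    crossing _                   _                   = 0ℚ

    -- All weight goes to the two-block partitions; the partition into three singletons gets 0.
    antipodal : Vec Bool 3 → List (Subset 3) → ℚ
    antipodal x (_ ∷ T ∷ []) = crossing T x
    antipodal x _            = 0ℚ

    -- Meant for x and y that differ in at most two places: the whole product sits on the one
    -- partition with at most one block.
    near : Vec Bool 3 → Vec Bool 3 → List (Subset 3) → ℚ
    near x y []       = F x * F y
    near x y (_ ∷ []) = F x * F y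
    near x y _        = 0ℚ

    β : Vec Bool 3 → Vec Bool 3 → Vec Bool 3 → List (Subset 3) → ℚ
    β (1ᵇ ∷ 1ᵇ ∷ 1ᵇ ∷ []) x y = antipodal x
    β _                   x y = near x y

    0≤crossing : ∀ T x → 0ℚ ≤ crossing T x
    0≤crossing (0ᵇ ∷ 0ᵇ ∷ 1ᵇ ∷ []) (x₁ ∷ x₂ ∷ x₃ ∷ []) = ifNonNeg (x₁ xor x₂) 0≤u₁₂ 0≤u₀₃
    0≤crossing (0ᵇ ∷ 1ᵇ ∷ 0ᵇ ∷ []) (x₁ ∷ x₂ ∷ x₃ ∷ []) = ifNonNeg (x₁ xor x₃) 0≤u₁₃ 0≤u₀₂
    0≤crossing (0ᵇ ∷ 1ᵇ ∷ 1ᵇ ∷ []) (x₁ ∷ x₂ ∷ x₃ ∷ []) = ifNonNeg (x₂ xor x₃) 0≤u₂₃ 0≤u₀₁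
    0≤crossing (0ᵇ ∷ 0ᵇ ∷ 0ᵇ ∷ []) _                   = ≤-refl
    0≤crossing (1ᵇ ∷ _)            _                   = ≤-refl

    0≤antipodal : ∀ x M → 0ℚ ≤ antipodal x M
    0≤antipodal x []              = ≤-refl
    0≤antipodal x (_ ∷ [])        = ≤-refl
    0≤antipodal x (_ ∷ T ∷ [])    = 0≤crossing T x
    0≤antipodal x (_ ∷ _ ∷ _ ∷ _) = ≤-refl

    0≤near : ∀ x y M → 0ℚ ≤ near x y M
    0≤near x y []          = 0≤* (0≤F x) (0≤F y)
    0≤near x y (_ ∷ [])    = 0≤* (0≤F x) (0≤F y)
    0≤near x y (_ ∷ _ ∷ _) = ≤-refl

    -- Reduces eight differences to the two shapes of `β`. The predicate also sees `z`, so that an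
    -- equation x ⊕ y ≡ z can be carried into the branches.
    β-case : (P : Vec Bool 3 → (Vec Bool 3 → Vec Bool 3 → List (Subset 3) → ℚ) → Set) →
             P ones (λ x y → antipodal x) → (∀ z → P z near) → ∀ z → P z (β z)
    β-case P far close (1ᵇ ∷ 1ᵇ ∷ 1ᵇ ∷ []) = far
    β-case P far close (1ᵇ ∷ 1ᵇ ∷ 0ᵇ ∷ []) = close _
    β-case P far close (1ᵇ ∷ 0ᵇ ∷ _ ∷ [])  = close _
    β-case P far close (0ᵇ ∷ _ ∷ _ ∷ [])   = close _

    -- The vertex sums, reordered as `Match′ ones` lists the partitions: M₃, M₂, M₁, then 0 for M₀
    -- and 0 for the empty sum.
    class₀ : F (0ᵇ ∷ 0ᵇ ∷ 0ᵇ ∷ []) * F ones ≡ u₀₃ + (u₀₂ + (u₀₁ + (0ℚ + 0ℚ)))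
    class₀ = trans sum₀ (solve 3 (λ a b c →
      a :+ b :+ c := c :+ (b :+ (a :+ (con 0ℚ :+ con 0ℚ)))) refl u₀₁ u₀₂ u₀₃)
    class₁ : F S₁ * F (0ᵇ ∷ 1ᵇ ∷ 1ᵇ ∷ []) ≡ u₁₂ + (u₁₃ + (u₀₁ + (0ℚ + 0ℚ)))
    class₁ = trans sum₁ (solve 3 (λ a b c →
      a :+ b :+ c := b :+ (c :+ (a :+ (con 0ℚ :+ con 0ℚ)))) refl u₀₁ u₁₂ u₁₃)
    class₂ : F S₂ * F (1ᵇ ∷ 0ᵇ ∷ 1ᵇ ∷ []) ≡ u₁₂ + (u₀₂ + (u₂₃ + (0ℚ + 0ℚ)))
    class₂ = trans sum₂ (solve 3 (λ a b c →
      a :+ b :+ c := b :+ (a :+ (c :+ (con 0ℚ :+ con 0ℚ)))) refl u₀₂ u₁₂ u₂₃)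
    class₃ : F S₃ * F (1ᵇ ∷ 1ᵇ ∷ 0ᵇ ∷ []) ≡ u₀₃ + (u₁₃ + (u₂₃ + (0ℚ + 0ℚ)))
    class₃ = trans sum₃ (solve 3 (λ a b c →
      a :+ b :+ c := a :+ (b :+ (c :+ (con 0ℚ :+ con 0ℚ)))) refl u₀₃ u₁₃ u₂₃)

    antipodal-sum : ∀ x → F x * F (x ⊕ ones) ≡ Σℚ (Match′ ones) (antipodal x)
    antipodal-sum (0ᵇ ∷ 0ᵇ ∷ 0ᵇ ∷ []) = class₀
    antipodal-sum (1ᵇ ∷ 1ᵇ ∷ 1ᵇ ∷ []) = trans (*-comm (F _) (F _)) class₀
    antipodal-sum (1ᵇ ∷ 0ᵇ ∷ 0ᵇ ∷ []) = class₁
    antipodal-sum (0ᵇ ∷ 1ᵇ ∷ 1ᵇ ∷ []) = trans (*-comm (F _) (F _)) class₁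
    antipodal-sum (0ᵇ ∷ 1ᵇ ∷ 0ᵇ ∷ []) = class₂
    antipodal-sum (1ᵇ ∷ 0ᵇ ∷ 1ᵇ ∷ []) = trans (*-comm (F _) (F _)) class₂
    antipodal-sum (0ᵇ ∷ 0ᵇ ∷ 1ᵇ ∷ []) = class₃
    antipodal-sum (1ᵇ ∷ 1ᵇ ∷ 0ᵇ ∷ []) = trans (*-comm (F _) (F _)) class₃

    β-sum : ∀ z x y → y ≡ x ⊕ z → F x * F y ≡ Σℚ (Match′ z) (β z x y)
    β-sum (1ᵇ ∷ 1ᵇ ∷ 1ᵇ ∷ []) x _ refl = antipodal-sum x
    β-sum (1ᵇ ∷ 1ᵇ ∷ 0ᵇ ∷ []) x y _    = sym (+-identityʳ (F x * F y))
    β-sum (1ᵇ ∷ 0ᵇ ∷ 1ᵇ ∷ []) x y _    = sym (+-identityʳ (F x * F y))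
    β-sum (1ᵇ ∷ 0ᵇ ∷ 0ᵇ ∷ []) x y _    = sym (+-identityʳ (F x * F y))
    β-sum (0ᵇ ∷ 1ᵇ ∷ 1ᵇ ∷ []) x y _    = sym (+-identityʳ (F x * F y))
    β-sum (0ᵇ ∷ 1ᵇ ∷ 0ᵇ ∷ []) x y _    = sym (+-identityʳ (F x * F y))
    β-sum (0ᵇ ∷ 0ᵇ ∷ 1ᵇ ∷ []) x y _    = sym (+-identityʳ (F x * F y))
    β-sum (0ᵇ ∷ 0ᵇ ∷ 0ᵇ ∷ []) x y _    = sym (+-identityʳ (F x * F y))

    if-xor : ∀ a b c {p q : ℚ} →
             (if a xor b then p else q) ≡ (if (a xor c) xor (b xor c) then p else q)
    if-xor a b c {p} {q} = cong (if_then p else q) (sym (xor-cancel a b c))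

    -- `crossing` compares two coordinates of the same block, or of the complement of a singleton
    -- block; flipping a block changes both or neither.
    antipodal-invariant : ∀ x M S → M ∈ˡ Match′ ones → S ∈ˡ M → antipodal x M ≡ antipodal (x ⊕ S) M
    antipodal-invariant (x₁ ∷ x₂ ∷ x₃ ∷ []) _ _ (here refl) (here refl)                 = if-xor x₁ x₂ 1ᵇ
    antipodal-invariant (x₁ ∷ x₂ ∷ x₃ ∷ []) _ _ (here refl) (there (here refl))         = if-xor x₁ x₂ 0ᵇ
    antipodal-invariant (x₁ ∷ x₂ ∷ x₃ ∷ []) _ _ (there (here refl)) (here refl)         = if-xor x₁ x₃ 1ᵇ
    antipodal-invariant (x₁ ∷ x₂ ∷ x₃ ∷ []) _ _ (there (here refl)) (there (here refl)) = if-xor x₁ x₃ 0ᵇ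
    antipodal-invariant (x₁ ∷ x₂ ∷ x₃ ∷ []) _ _ (there (there (here refl))) (here refl) = if-xor x₂ x₃ 0ᵇ
    antipodal-invariant (x₁ ∷ x₂ ∷ x₃ ∷ []) _ _ (there (there (here refl))) (there (here refl)) =
      if-xor x₂ x₃ 1ᵇ
    antipodal-invariant x _ _ (there (there (there (here refl)))) _ = refl

    -- A single block is all of x ⊕ y, so flipping it exchanges x and y.
    near-invariant : ∀ x y M S → M ∈ˡ Match′ (x ⊕ y) → S ∈ˡ M → near x y M ≡ near (x ⊕ S) (y ⊕ S) M
    near-invariant x y (S ∷ []) _ M∈ (here refl)
      with proj₂ (∈-filter⁻ (isPartition? oneOrTwo? (x ⊕ y)) {xs = sublists (subsets 3)} M∈)
    ... | _ , _ , S∪⊥≡x⊕y with trans (sym (∪-identityʳ S)) S∪⊥≡x⊕y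
    ... | refl = trans (*-comm (F x) (F y)) (sym (cong₂ (λ p q → F p * F q)
      (⊕-involutiveˡ x y) (trans (cong (y ⊕_) (⊕-comm x y)) (⊕-involutiveˡ y x))))
    near-invariant x y (_ ∷ _ ∷ _) S _ _ = refl

  complementInequality⇒windable : Windable F
  complementInequality⇒windable = record
    { B           = λ x y → β (x ⊕ y) x y
    ; nonNegative = λ x y M _ → β-case (λ _ b → 0ℚ ≤ b x y M) (0≤antipodal x M) (λ _ → 0≤near x y M) (x ⊕ y)
    ; sums        = λ x y → β-sum (x ⊕ y) x y (sym (⊕-involutiveˡ x y))
    ; invariant   = λ x y M S M∈ S∈M → trans
        (β-case (λ z b → x ⊕ y ≡ z → b x y M ≡ b (x ⊕ S) (y ⊕ S) M)
          (λ eq → antipodal-invariant x M S (subst (λ z → M ∈ˡ Match′ z) eq M∈) S∈M)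
          (λ _ _ → near-invariant x y M S M∈ S∈M) (x ⊕ y) refl)
        -- Flipping both arguments preserves their difference, hence the branch of `β`.
        (cong (λ z → β z (x ⊕ S) (y ⊕ S) M) (sym (⊕-cancel x y S)))
    }

theorem4 : (F : Vec Bool 3 → ℚ) → (∀ x → 0ℚ ≤ F x) →
    (Windable F ⇔ ComplementInequality F) × (ComplementInequality F ⇔ HasMatchingsCircuit F)
theorem4 F 0≤F =
  mk⇔ windable⇒complementInequality (complementInequality⇒windable 0≤F) ,
  mk⇔ toCircuit fromCircuit
  where
  toCircuit : ComplementInequality F → HasMatchingsCircuit F
  toCircuit ineq with realize (λ x y z → F (x ∷ y ∷ z ∷ [])) (λ x y z → 0≤F (x ∷ y ∷ z ∷ [])) ineq
  ... | Γ , F≡sig = Realization.hasMatchingsCircuit Γ F F≡sig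

  fromCircuit : HasMatchingsCircuit F → ComplementInequality F
  fromCircuit (G , φ , F≡signature) with Circuit.realizable G φ
  ... | Γ , signature≡sig = inequality-cong (λ x y z → trans (F≡signature _) (signature≡sig x y z))
    (SignatureInequality.sig-inequality Γ)
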